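{- Let $R=\bigoplus_{i\ge 0}R_i$ be a standard graded algebra over a field $\mathbb{K}$, with Hilbert function $h_i=\dim_{\mathbb{K}}R_i$ for all $i\ge 0$. Let $r\ge 1$ be an integer. Let $x\ge r-1$ be the unique real number satisfying $h_r=\binom{x}{r}$. Then $$h_{r-1}\ \ge\ \binom{x-1}{r-1}\quad\text{and}\quad h_{r+1}\ \le\ \binom{x+1}{r+1}.$$
   Context: A standard graded algebra over a field $\mathbb{K}$ is a commutative $\mathbb{K}$-algebra $R$ with a vector space decomposition $R=\bigoplus_{i\ge 0}R_i$ such that $R_0=\mathbb{K}$, $R_iR_j\subseteq R_{i+j}$ for all $i,j\ge 0$, and $R$ is generated as a $\mathbb{K}$-algebra by finitely many elements of $R_1$ (so each $R_i$ is finite-dimensional). For $x\in\mathbb{R}$ and an integer $i\ge 1$, $\binom{x}{i}=\frac{x(x-1)\cdots(x-i+1)}{i!}$, and $\binom{x}{0}=1$. For $i\ge1$, the map $x\mapsto\binom{x}{i}$ is an increasing bijection from the real interval $[i-1,\infty)$ onto $[0,\infty)$. -}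

module Defs where

open import Algebra.Apartness.Bundles using (HeytingField; HeytingCommutativeRing)
open import Algebra.Bundles using (CommutativeRing)
open import Algebra.Morphism.Structures using (IsRingHomomorphism)
import Algebra.Properties.CommutativeMonoid.Sum as Sum
open import Data.Fin.Base using (Fin; toℕ)
open import Data.Integer.Base using (+_)
open import Data.Nat.Base as ℕ using (ℕ; zero; suc; _!)
import Data.Nat.Properties as ℕ
open import Data.Product.Base using (Σ; ∃; _×_; _,_)
open import Data.Rational.Base as ℚ
  using (ℚ; 0ℚ; 1ℚ; ½; _+_; _*_; _-_; -_; ∣_∣; _≤_; _<_; 1/_)
open import Data.Rational.Properties as ℚ
open import Data.Rational.Solver using (module +-*-Solver)
open import Level using (Level; _⊔_) renaming (suc to lsuc)
open import Relation.Binary.PropositionalEquality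
  using (_≡_; refl; sym; trans; cong; cong₂; subst)
open import Relation.Unary using (Pred)

-- Real numbers: Cauchy sequences of rationals, with a modulus of convergence.

IsCauchy : (ℕ → ℚ) → Set
IsCauchy s = ∀ ε → 0ℚ < ε →
  ∃ λ N → ∀ m n → N ℕ.≤ m → N ℕ.≤ n → ∣ s m - s n ∣ ≤ ε

record ℝ : Set where
  constructor mkℝ
  field
    seq    : ℕ → ℚ
    cauchy : IsCauchy seq

open ℝ public

infix 4 _≈ℝ_ _≤ℝ_

_≈ℝ_ : ℝ → ℝ → Set
x ≈ℝ y = ∀ ε → 0ℚ < ε → ∃ λ N → ∀ n → N ℕ.≤ n → ∣ seq x n - seq y n ∣ ≤ ε

_≤ℝ_ : ℝ → ℝ → Set
x ≤ℝ y = ∀ ε → 0ℚ < ε → ∃ λ N → ∀ n → N ℕ.≤ n → seq x n ≤ seq y n + ε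

private
  open +-*-Solver

  +-diff : ∀ a b c d → (a + b) - (c + d) ≡ (a - c) + (b - d)
  +-diff = solve 4 (λ a b c d → (a :+ b) :- (c :+ d) := (a :- c) :+ (b :- d)) refl

  neg-diff : ∀ a b → - (a - b) ≡ (- a) - (- b)
  neg-diff = solve 2 (λ a b → :- (a :- b) := (:- a) :- (:- b)) refl

  diff-add : ∀ a b → a ≡ (a - b) + b
  diff-add = solve 2 (λ a b → a := (a :- b) :+ b) refl

  *-diff : ∀ a b c d → a * b - c * d ≡ a * (b - d) + d * (a - c)
  *-diff = solve 4 (λ a b c d → a :* b :- c :* d := a :* (b :- d) :+ d :* (a :- c)) refl

  half-pos : ∀ {ε} → 0ℚ < ε → 0ℚ < ½ * ε
  half-pos {ε} 0<ε = subst (_< ½ * ε) (*-zeroʳ ½) (*-monoʳ-<-pos ½ 0<ε)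

  half+half : ∀ ε → ½ * ε + ½ * ε ≡ ε
  half+half ε = trans (sym (*-distribʳ-+ ε ½ ½)) (*-identityˡ ε)

  const-cauchy : ∀ q → IsCauchy (λ _ → q)
  const-cauchy q ε 0<ε = 0 , λ _ _ _ _ →
    subst (_≤ ε) (cong ∣_∣ (sym (+-inverseʳ q))) (<⇒≤ 0<ε)

  +-cauchy : ∀ {s t} → IsCauchy s → IsCauchy t → IsCauchy (λ n → s n + t n)
  +-cauchy {s} {t} cs ct ε 0<ε
    with cs (½ * ε) (half-pos 0<ε) | ct (½ * ε) (half-pos 0<ε)
  ... | M , hM | N , hN = M ℕ.⊔ N , λ m n m≥ n≥ → begin
    ∣ (s m + t m) - (s n + t n) ∣
      ≡⟨ cong ∣_∣ (+-diff (s m) (t m) (s n) (t n)) ⟩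
    ∣ (s m - s n) + (t m - t n) ∣       ≤⟨ ∣p+q∣≤∣p∣+∣q∣ (s m - s n) (t m - t n) ⟩
    ∣ s m - s n ∣ + ∣ t m - t n ∣
      ≤⟨ +-mono-≤ (hM m n (ℕ.m⊔n≤o⇒m≤o M N m≥) (ℕ.m⊔n≤o⇒m≤o M N n≥))
                  (hN m n (ℕ.m⊔n≤o⇒n≤o M N m≥) (ℕ.m⊔n≤o⇒n≤o M N n≥)) ⟩
    ½ * ε + ½ * ε                       ≡⟨ half+half ε ⟩
    ε                                   ∎
    where open ≤-Reasoning

  neg-cauchy : ∀ {s} → IsCauchy s → IsCauchy (λ n → - s n)
  neg-cauchy {s} cs ε 0<ε with cs ε 0<ε
  ... | N , hN = N , λ m n m≥ n≥ → subst (_≤ ε)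
    (trans (sym (∣-p∣≡∣p∣ (s m - s n)))
      (cong ∣_∣ (neg-diff (s m) (s n))))
    (hN m n m≥ n≥)

  EventuallyBounded : (ℕ → ℚ) → Set
  EventuallyBounded s = ∃ λ B → ℚ.Positive B × ∃ λ N → ∀ n → N ℕ.≤ n → ∣ s n ∣ ≤ B

  bounded : ∀ {s} → IsCauchy s → EventuallyBounded s
  bounded {s} cs with cs 1ℚ (positive⁻¹ 1ℚ)
  ... | N , hN = 1ℚ + ∣ s N ∣
    , pos+nonNeg⇒pos 1ℚ ∣ s N ∣ {{∣-∣-nonNeg (s N)}}
    , N , λ n n≥ → begin
      ∣ s n ∣
        ≡⟨ cong ∣_∣ (diff-add (s n) (s N)) ⟩
      ∣ (s n - s N) + s N ∣        ≤⟨ ∣p+q∣≤∣p∣+∣q∣ (s n - s N) (s N) ⟩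
      ∣ s n - s N ∣ + ∣ s N ∣      ≤⟨ +-monoˡ-≤ ∣ s N ∣ (hN n N n≥ ℕ.≤-refl) ⟩
      1ℚ + ∣ s N ∣                 ∎
    where open ≤-Reasoning

  shrink : ∀ B → ℚ.Positive B → ∀ {ε} → 0ℚ < ε → ∃ λ δ → 0ℚ < δ × B * δ ≡ ε
  shrink B B>0 {ε} 0<ε = (1/ B) * ε
    , subst (_< (1/ B) * ε) (*-zeroʳ (1/ B)) (*-monoʳ-<-pos (1/ B) 0<ε)
    , trans (sym (*-assoc B (1/ B) ε))
        (trans (cong (_* ε) (*-inverseʳ B)) (*-identityˡ ε))
    where
    instance
      _ = B>0
      _ = pos⇒nonZero B
      _ = 1/pos⇒pos B

  mul-bound : ∀ u v B δ → ℚ.Positive B → ∣ u ∣ ≤ B → ∣ v ∣ ≤ δ → ∣ u * v ∣ ≤ B * δ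
  mul-bound u v B δ B>0 u≤ v≤ = begin
    ∣ u * v ∣        ≡⟨ ∣p*q∣≡∣p∣*∣q∣ u v ⟩
    ∣ u ∣ * ∣ v ∣    ≤⟨ *-monoʳ-≤-nonNeg ∣ v ∣ {{∣-∣-nonNeg v}} u≤ ⟩
    B * ∣ v ∣        ≤⟨ *-monoˡ-≤-nonNeg B {{pos⇒nonNeg B {{B>0}}}} v≤ ⟩
    B * δ            ∎
    where open ≤-Reasoning

  *-estimate : ∀ a b c d {B C δ η ε} → ℚ.Positive B → ℚ.Positive C →
    B * δ ≡ ½ * ε → C * η ≡ ½ * ε →
    ∣ a ∣ ≤ B → ∣ b - d ∣ ≤ δ → ∣ d ∣ ≤ C → ∣ a - c ∣ ≤ η → ∣ a * b - c * d ∣ ≤ ε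
  *-estimate a b c d {B} {C} {δ} {η} {ε} B>0 C>0 Bδ≡ Cη≡ a≤ bd≤ d≤ ac≤ = begin
    ∣ a * b - c * d ∣                        ≡⟨ cong ∣_∣ (*-diff a b c d) ⟩
    ∣ a * (b - d) + d * (a - c) ∣            ≤⟨ ∣p+q∣≤∣p∣+∣q∣ (a * (b - d)) (d * (a - c)) ⟩
    ∣ a * (b - d) ∣ + ∣ d * (a - c) ∣
      ≤⟨ +-mono-≤ (mul-bound a (b - d) B δ B>0 a≤ bd≤) (mul-bound d (a - c) C η C>0 d≤ ac≤) ⟩
    B * δ + C * η                            ≡⟨ cong₂ _+_ Bδ≡ Cη≡ ⟩
    ½ * ε + ½ * ε                            ≡⟨ half+half ε ⟩
    ε                                        ∎
    where open ≤-Reasoning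

  *-cauchy : ∀ {s t} → IsCauchy s → IsCauchy t → IsCauchy (λ n → s n * t n)
  *-cauchy {s} {t} cs ct ε 0<ε =
    let B , B>0 , N₁ , hB = bounded {s} cs
        C , C>0 , N₂ , hC = bounded {t} ct
        δ , 0<δ , Bδ≡     = shrink B B>0 (half-pos 0<ε)
        η , 0<η , Cη≡     = shrink C C>0 (half-pos 0<ε)
        N₃ , ht           = ct δ 0<δ
        N₄ , hs           = cs η 0<η
        M₁                = N₁ ℕ.⊔ N₂
        M₂                = N₃ ℕ.⊔ N₄
    in M₁ ℕ.⊔ M₂ , λ m n m≥ n≥ →
      let m≥M₁ = ℕ.m⊔n≤o⇒m≤o M₁ M₂ m≥
          m≥M₂ = ℕ.m⊔n≤o⇒n≤o M₁ M₂ m≥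
          n≥M₁ = ℕ.m⊔n≤o⇒m≤o M₁ M₂ n≥
          n≥M₂ = ℕ.m⊔n≤o⇒n≤o M₁ M₂ n≥
      in *-estimate (s m) (t m) (s n) (t n) {B} {C} {δ} {η} {ε} B>0 C>0 Bδ≡ Cη≡
           (hB m (ℕ.m⊔n≤o⇒m≤o N₁ N₂ m≥M₁))
           (ht m n (ℕ.m⊔n≤o⇒m≤o N₃ N₄ m≥M₂) (ℕ.m⊔n≤o⇒m≤o N₃ N₄ n≥M₂))
           (hC n (ℕ.m⊔n≤o⇒n≤o N₁ N₂ n≥M₁))
           (hs m n (ℕ.m⊔n≤o⇒n≤o N₃ N₄ m≥M₂) (ℕ.m⊔n≤o⇒n≤o N₃ N₄ n≥M₂))

infixl 6 _+ℝ_ _-ℝ_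
infixl 7 _*ℝ_

fromℚ : ℚ → ℝ
fromℚ q = mkℝ (λ _ → q) (const-cauchy q)

fromℕ : ℕ → ℝ
fromℕ n = fromℚ (+ n ℚ./ 1)

_+ℝ_ : ℝ → ℝ → ℝ
x +ℝ y = mkℝ (λ n → seq x n + seq y n) (+-cauchy {seq x} {seq y} (cauchy x) (cauchy y))

-ℝ_ : ℝ → ℝ
-ℝ x = mkℝ (λ n → - seq x n) (neg-cauchy {seq x} (cauchy x))

_-ℝ_ : ℝ → ℝ → ℝ
x -ℝ y = x +ℝ (-ℝ y)

_*ℝ_ : ℝ → ℝ → ℝ
x *ℝ y = mkℝ (λ n → seq x n * seq y n) (*-cauchy {seq x} {seq y} (cauchy x) (cauchy y))

-- x (x - 1) ⋯ (x - i + 1)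
fallingFactorial : ℝ → ℕ → ℝ
fallingFactorial x zero    = fromℕ 1
fallingFactorial x (suc i) = fallingFactorial x i *ℝ (x -ℝ fromℕ i)

binomial : ℝ → ℕ → ℝ
binomial x i = fallingFactorial x i *ℝ fromℚ ((+ 1 ℚ./ i !) {{i ℕ.!≢0}})

-- A commutative K-algebra is a commutative ring with a ring homomorphism ι from
-- K; the scalar action is c • x = ι c * x.  The library's HeytingField is
-- classically just a field: tightness forces x # y to mean that x and y differ.
-- Nontriviality 1 # 0 follows from invertible⇒#.

record CommutativeAlgebra {c ℓ₁ ℓ₂} (K : HeytingField c ℓ₁ ℓ₂) (a ℓ : Level)
    : Set (c ⊔ ℓ₁ ⊔ lsuc (a ⊔ ℓ)) where
  private
    module K = HeytingField K
    KR = HeytingCommutativeRing.commutativeRing K.heytingCommutativeRing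
  field
    commutativeRing    : CommutativeRing a ℓ
    ι                  : K.Carrier → CommutativeRing.Carrier commutativeRing
    isRingHomomorphism : IsRingHomomorphism (CommutativeRing.rawRing KR)
                           (CommutativeRing.rawRing commutativeRing) ι

  open CommutativeRing commutativeRing public
    renaming (_+_ to _+ᴬ_; _*_ to _*ᴬ_; -_ to -ᴬ_; _-_ to _-ᴬ_)
  open Sum +-commutativeMonoid public using (sum)

  infixr 7 _•_
  _•_ : K.Carrier → Carrier → Carrier
  c • x = ι c *ᴬ x

  record IsSubspace {p} (V : Pred Carrier p) : Set (c ⊔ a ⊔ ℓ ⊔ p) where
    field
      resp     : ∀ {x y} → x ≈ y → V x → V y
      0-closed : V 0#
      +-closed : ∀ {x y} → V x → V y → V (x +ᴬ y)
      •-closed : ∀ c {x} → V x → V (c • x)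

  -- The subalgebra generated by g₀, …, gₘ₋₁.
  data Adjoin {m} (g : Fin m → Carrier) : Pred Carrier (c ⊔ a ⊔ ℓ) where
    generator : ∀ i → Adjoin g (g i)
    scalar    : ∀ c → Adjoin g (ι c)
    plus      : ∀ {x y} → Adjoin g x → Adjoin g y → Adjoin g (x +ᴬ y)
    times     : ∀ {x y} → Adjoin g x → Adjoin g y → Adjoin g (x *ᴬ y)
    resp      : ∀ {x y} → x ≈ y → Adjoin g x → Adjoin g y

  linearCombination : ∀ {d} → (Fin d → K.Carrier) → (Fin d → Carrier) → Carrier
  linearCombination k b = sum (λ i → k i • b i)

  record IsBasis {p d} (V : Pred Carrier p) (b : Fin d → Carrier)
      : Set (c ⊔ ℓ₁ ⊔ a ⊔ ℓ ⊔ p) where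
    field
      member      : ∀ i → V (b i)
      spanning    : ∀ {x} → V x → ∃ λ k → x ≈ linearCombination k b
      independent : ∀ k → linearCombination k b ≈ 0# → ∀ i → k i K.≈ K.0#

  HasDimension : ∀ {p} → Pred Carrier p → ℕ → Set (c ⊔ ℓ₁ ⊔ a ⊔ ℓ ⊔ p)
  HasDimension V d = Σ (Fin d → Carrier) (IsBasis V)

record StandardGradedAlgebra {c ℓ₁ ℓ₂} (K : HeytingField c ℓ₁ ℓ₂) (a ℓ p : Level)
    : Set (c ⊔ ℓ₁ ⊔ lsuc (a ⊔ ℓ ⊔ p)) where
  private module K = HeytingField K
  field
    algebra : CommutativeAlgebra K a ℓ

  open CommutativeAlgebra algebra public

  field
    component            : ℕ → Pred Carrier p
    component-isSubspace : ∀ i → IsSubspace (component i)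

    -- R is the internal direct sum of the components: every element is a finite
    -- sum u₀ + ⋯ + uₙ₋₁ with uᵢ in degree i, and such a sum vanishes only if
    -- every uᵢ does.
    decompose   : ∀ x → ∃ λ n → Σ (Fin n → Carrier) λ u →
                    (∀ i → component (toℕ i) (u i)) × x ≈ sum u
    independent : ∀ {n} (u : Fin n → Carrier) → (∀ i → component (toℕ i) (u i)) →
                    sum u ≈ 0# → ∀ i → u i ≈ 0#

    -- R₀ = K: ι is a bijection from K onto R₀.
    ι-injective  : ∀ {k l} → ι k ≈ ι l → k K.≈ l
    ι-component₀ : ∀ k → component 0 (ι k)
    component₀-ι : ∀ {x} → component 0 x → ∃ λ k → x ≈ ι k

    *-graded : ∀ {i j x y} → component i x → component j y →
                 component (i ℕ.+ j) (x *ᴬ y)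

    generated : ∃ λ m → Σ (Fin m → Carrier) λ g →
                  (∀ i → component 1 (g i)) × (∀ x → Adjoin g x)

  IsHilbertFunction : (ℕ → ℕ) → Set (c ⊔ ℓ₁ ⊔ a ⊔ ℓ ⊔ p)
  IsHilbertFunction h = ∀ i → HasDimension (component i) (h i)

{-# OPTIONS --safe #-}
module Submission where

-- In each degree the monomials in the generators that are not combinations of lexicographically
-- smaller ones form a basis of the component.  If x_v m is such a monomial then so is m, so it
-- suffices to bound families f, g of monomials of degrees r+1 and r with f(x_v m) ≤ g(m).
--
-- The bound is an averaging argument of Keevash.  Let D_v(g) be the sum over g of the exponent
-- of x_v.  For q ≥ r-1 and |g| ≤ C(q,r), induction on r gives r D_v(f) ≤ (q+1) D_v(g) for every
-- v, and summing over v yields (r+1) |f| ≤ (q+1) |g|, which is the upper bound with q for x.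
--   * If D_v(g) < C(q,r-1): D_v counts the monomials obtained by splitting x_v into two
--     variables, which form families of degrees r and r-1, and the induction hypothesis applies.
--   * Otherwise D_v(f) ≤ |g| + D_v(g), and |g| ≤ C(q,r) ≤ (q-r+1)/r D_v(g).
-- The lower bound follows from the upper bound one degree below.
--
-- Only inequalities between rationals are concluded from the algebra, so they are stable
-- under double negation, and one may decide whether finitely many scalars vanish.

open import Defs

-- Sums over monomials and the splitting of a variable

module MonomialSums where
  open import Data.Fin.Base using (Fin; zero; suc)
  open import Data.Nat.Base as ℕ using (ℕ; zero; suc)
  import Data.Nat.Properties as ℕ
  open import Data.Nat.Tactic.RingSolver using (solve-∀)
  open import Data.Product.Base using (∃; _,_)
  open import Data.Vec.Base as Vec using (Vec; []; _∷_; lookup)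
  open import Function.Base using (_∘_)
  open import Relation.Binary.PropositionalEquality
  open import Algebra.Properties.Semiring.Sum ℕ.+-*-semiring renaming (sum to ∑)

  private
    variable
      n : ℕ

  -- Vectors are exponent vectors of monomials; this is multiplication by the variable v.
  bump : Fin n → Vec ℕ n → Vec ℕ n
  bump zero    (a ∷ m) = suc a ∷ m
  bump (suc v) (a ∷ m) = a ∷ bump v m

  -- The monomials of degree d in n variables are split according to
  -- divisibility by the first variable.
  ∑ᵐ : ∀ n (d : ℕ) → (Vec ℕ n → ℕ) → ℕ
  ∑ᵐ zero    zero    f = f []
  ∑ᵐ zero    (suc d) f = 0
  ∑ᵐ (suc n) zero    f = ∑ᵐ n zero (f ∘ (0 ∷_))
  ∑ᵐ (suc n) (suc d) f = ∑ᵐ (suc n) d (f ∘ bump zero) ℕ.+ ∑ᵐ n (suc d) (f ∘ (0 ∷_))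

  ∑ᵐ-mono : ∀ n (d : ℕ) {f g : Vec ℕ n → ℕ} → (∀ m → Vec.sum m ≡ d → f m ℕ.≤ g m) → ∑ᵐ n d f ℕ.≤ ∑ᵐ n d g
  ∑ᵐ-mono zero    zero    f≤g = f≤g [] refl
  ∑ᵐ-mono zero    (suc d) f≤g = ℕ.z≤n
  ∑ᵐ-mono (suc n) zero    f≤g = ∑ᵐ-mono n zero λ m → f≤g (0 ∷ m)
  ∑ᵐ-mono (suc n) (suc d) f≤g = ℕ.+-mono-≤
    (∑ᵐ-mono (suc n) d λ { (a ∷ m) eq → f≤g (suc a ∷ m) (cong suc eq) })
    (∑ᵐ-mono n (suc d) λ m → f≤g (0 ∷ m))

  ∑ᵐ-cong : ∀ n (d : ℕ) {f g : Vec ℕ n → ℕ} → (∀ m → Vec.sum m ≡ d → f m ≡ g m) → ∑ᵐ n d f ≡ ∑ᵐ n d g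
  ∑ᵐ-cong n d f≡g = ℕ.≤-antisym (∑ᵐ-mono n d λ m eq → ℕ.≤-reflexive (f≡g m eq))
                               (∑ᵐ-mono n d λ m eq → ℕ.≤-reflexive (sym (f≡g m eq)))

  ∑ᵐ-+ : ∀ n (d : ℕ) (f g : Vec ℕ n → ℕ) → ∑ᵐ n d (λ m → f m ℕ.+ g m) ≡ ∑ᵐ n d f ℕ.+ ∑ᵐ n d g
  ∑ᵐ-+ zero    zero    f g = refl
  ∑ᵐ-+ zero    (suc d) f g = refl
  ∑ᵐ-+ (suc n) zero    f g = ∑ᵐ-+ n zero _ _
  ∑ᵐ-+ (suc n) (suc d) f g
    rewrite ∑ᵐ-+ (suc n) d (f ∘ bump zero) (g ∘ bump zero) | ∑ᵐ-+ n (suc d) (f ∘ (0 ∷_)) (g ∘ (0 ∷_))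
    = +-+ (∑ᵐ (suc n) d _) _ _ _
    where
    +-+ : ∀ a b c e → (a ℕ.+ b) ℕ.+ (c ℕ.+ e) ≡ (a ℕ.+ c) ℕ.+ (b ℕ.+ e)
    +-+ = solve-∀

  ∑ᵐ-0 : ∀ n (d : ℕ) → ∑ᵐ n d (λ _ → 0) ≡ 0
  ∑ᵐ-0 zero    zero    = refl
  ∑ᵐ-0 zero    (suc d) = refl
  ∑ᵐ-0 (suc n) zero    = ∑ᵐ-0 n zero
  ∑ᵐ-0 (suc n) (suc d) = cong₂ ℕ._+_ (∑ᵐ-0 (suc n) d) (∑ᵐ-0 n (suc d))

  ∑ᵐ-*ˡ : ∀ n (d : ℕ) k (f : Vec ℕ n → ℕ) → ∑ᵐ n d (λ m → k ℕ.* f m) ≡ k ℕ.* ∑ᵐ n d f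
  ∑ᵐ-*ˡ n d zero    f = ∑ᵐ-0 n d
  ∑ᵐ-*ˡ n d (suc k) f = trans (∑ᵐ-+ n d f (λ m → k ℕ.* f m)) (cong (∑ᵐ n d f ℕ.+_) (∑ᵐ-*ˡ n d k f))

  ∑ᵐ-∑ : ∀ n (d : ℕ) {k} (f : Fin k → Vec ℕ n → ℕ) → ∑ᵐ n d (λ m → ∑ λ v → f v m) ≡ ∑ λ v → ∑ᵐ n d (f v)
  ∑ᵐ-∑ n d {zero}  f = ∑ᵐ-0 n d
  ∑ᵐ-∑ n d {suc k} f = trans (∑ᵐ-+ n d (f zero) _) (cong (∑ᵐ n d (f zero) ℕ.+_) (∑ᵐ-∑ n d (f ∘ suc)))

  ∑-lookup : ∀ (m : Vec ℕ n) → ∑ (lookup m) ≡ Vec.sum m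
  ∑-lookup []      = refl
  ∑-lookup (a ∷ m) = cong (a ℕ.+_) (∑-lookup m)

  -- Its sum over the monomials of a fixed degree is the quantity D_v(f).
  weighted : Fin n → (Vec ℕ n → ℕ) → Vec ℕ n → ℕ
  weighted v f m = lookup m v ℕ.* f m

  -- The exponents of a monomial of degree d add up to d, so it is counted d times in all.
  ∑-weighted : ∀ n (d : ℕ) (f : Vec ℕ n → ℕ) → ∑ (λ v → ∑ᵐ n d (weighted v f)) ≡ d ℕ.* ∑ᵐ n d f
  ∑-weighted n d f = begin
    ∑ (λ v → ∑ᵐ n d (weighted v f))          ≡⟨ ∑ᵐ-∑ n d (λ v → weighted v f) ⟨
    ∑ᵐ n d (λ m → ∑ λ v → lookup m v ℕ.* f m)
      ≡⟨ ∑ᵐ-cong n d (λ m _ → sym (*-distribʳ-sum (f m) (lookup m))) ⟩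
    ∑ᵐ n d (λ m → ∑ (lookup m) ℕ.* f m)
      ≡⟨ ∑ᵐ-cong n d (λ m eq → cong (ℕ._* f m) (trans (∑-lookup m) eq)) ⟩
    ∑ᵐ n d (λ m → d ℕ.* f m)                 ≡⟨ ∑ᵐ-*ˡ n d d f ⟩
    d ℕ.* ∑ᵐ n d f                           ∎
    where open ≡-Reasoning

  ∑ᵐ-weighted-zero : ∀ n v (f : Vec ℕ n → ℕ) → ∑ᵐ n 0 (weighted v f) ≡ 0
  ∑ᵐ-weighted-zero (suc n) zero    f = ∑ᵐ-0 n 0
  ∑ᵐ-weighted-zero (suc n) (suc v) f = ∑ᵐ-weighted-zero n v _

  -- Only multiples of v carry weight, and each of them is `bump v m` for a unique m.
  ∑ᵐ-weighted : ∀ n (d : ℕ) v (f : Vec ℕ n → ℕ) →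
    ∑ᵐ n (suc d) (weighted v f) ≡ ∑ᵐ n d (λ m → suc (lookup m v) ℕ.* f (bump v m))
  ∑ᵐ-weighted (suc n) d zero f =
    trans (cong₂ ℕ._+_ (∑ᵐ-cong (suc n) d λ { (a ∷ m) _ → refl }) (∑ᵐ-0 n (suc d)))
          (ℕ.+-identityʳ _)
  ∑ᵐ-weighted (suc n) zero (suc v) f =
    cong₂ ℕ._+_ (∑ᵐ-weighted-zero n v _) (∑ᵐ-weighted n zero v _)
  ∑ᵐ-weighted (suc n) (suc d) (suc v) f = cong₂ ℕ._+_
    (trans (∑ᵐ-cong (suc n) (suc d) {weighted (suc v) f ∘ bump zero} {weighted (suc v) (f ∘ bump zero)}
             λ { (a ∷ m) _ → refl })
      (trans (∑ᵐ-weighted (suc n) d (suc v) (f ∘ bump zero))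
             (∑ᵐ-cong (suc n) d λ { (a ∷ m) _ → refl })))
    (∑ᵐ-weighted n (suc d) v _)

  -- Two copies of the variable v, with exponents a and b, are sent to v^(a+b+1), so that
  -- a monomial of v-exponent e ≥ 1 has exactly e preimages.
  merge : Fin n → Vec ℕ (suc n) → Vec ℕ n
  merge zero    (a ∷ b ∷ m) = suc (a ℕ.+ b) ∷ m
  merge (suc v) (a ∷ m)     = a ∷ merge v m

  sum-merge : ∀ (v : Fin n) m → Vec.sum (merge v m) ≡ suc (Vec.sum m)
  sum-merge zero    (a ∷ b ∷ m) = cong suc (ℕ.+-assoc a b (Vec.sum m))
  sum-merge (suc v) (a ∷ m)     = trans (cong (a ℕ.+_) (sum-merge v m)) (ℕ.+-suc a (Vec.sum m))

  -- Raising either copy of v raises v, and every other variable corresponds to itself. Hence the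
  -- shadow condition lifts along `merge`.
  merge-bump : ∀ (v : Fin n) u m → ∃ λ w → merge v (bump u m) ≡ bump w (merge v m)
  merge-bump zero    zero          (a ∷ b ∷ m) = zero , refl
  merge-bump zero    (suc zero)    (a ∷ b ∷ m) = zero , cong (λ c → suc c ∷ m) (ℕ.+-suc a b)
  merge-bump zero    (suc (suc u)) (a ∷ b ∷ m) = suc u , refl
  merge-bump (suc v) zero          (a ∷ m)     = zero , refl
  merge-bump (suc v) (suc u)       (a ∷ m)     with merge-bump v u m
  ... | w , eq = suc w , cong (a ∷_) eq

  ∑ᵐ-merge : ∀ n (d : ℕ) (v : Fin n) (f : Vec ℕ n → ℕ) →
    ∑ᵐ (suc n) d (f ∘ merge v) ≡ ∑ᵐ n (suc d) (weighted v f)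
  ∑ᵐ-merge (suc n) zero zero f = sym (trans (∑ᵐ-weighted (suc n) zero zero f)
    (∑ᵐ-cong n zero λ m _ → ℕ.+-identityʳ (f (1 ∷ m))))
  ∑ᵐ-merge (suc n) zero (suc v) f = trans (∑ᵐ-merge n zero v (f ∘ (0 ∷_)))
    (sym (cong (ℕ._+ ∑ᵐ n 1 (weighted v (f ∘ (0 ∷_)))) (∑ᵐ-weighted-zero n v _)))
  ∑ᵐ-merge (suc n) (suc d) zero f = begin
    -- Monomials divisible by the first copy account for the weight of `f ∘ bump zero`; those free
    -- of it correspond to all monomials `b ∷ m` and raise that weight by one.
    ∑ᵐ (suc (suc n)) d (f ∘ merge zero ∘ bump zero) ℕ.+ ∑ᵐ (suc n) (suc d) (f ∘ merge zero ∘ (0 ∷_))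
      ≡⟨ cong₂ ℕ._+_
           (trans (∑ᵐ-cong (suc (suc n)) d λ { (a ∷ b ∷ m) _ → refl })
                  (∑ᵐ-merge (suc n) d zero (f ∘ bump zero)))
           (∑ᵐ-cong (suc n) (suc d) {f ∘ merge zero ∘ (0 ∷_)} {f ∘ bump zero} λ { (a ∷ m) _ → refl }) ⟩
    ∑ᵐ (suc n) (suc d) (weighted zero (f ∘ bump zero)) ℕ.+ ∑ᵐ (suc n) (suc d) (f ∘ bump zero)
      ≡⟨ ∑ᵐ-+ (suc n) (suc d) (weighted zero (f ∘ bump zero)) (f ∘ bump zero) ⟨
    ∑ᵐ (suc n) (suc d) (λ m → weighted zero (f ∘ bump zero) m ℕ.+ f (bump zero m))
      ≡⟨ ∑ᵐ-cong (suc n) (suc d) (λ m _ → ℕ.+-comm (weighted zero (f ∘ bump zero) m) (f (bump zero m))) ⟩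
    ∑ᵐ (suc n) (suc d) (λ m → suc (lookup m zero) ℕ.* f (bump zero m))
      ≡⟨ ∑ᵐ-weighted (suc n) (suc d) zero f ⟨
    ∑ᵐ (suc n) (suc (suc d)) (weighted zero f) ∎
    where open ≡-Reasoning
  ∑ᵐ-merge (suc n) (suc d) (suc v) f = cong₂ ℕ._+_
    (trans (∑ᵐ-cong (suc (suc n)) d λ { (a ∷ m) _ → refl })
      (trans (∑ᵐ-merge (suc n) d (suc v) (f ∘ bump zero))
             (∑ᵐ-cong (suc n) (suc d) {weighted (suc v) (f ∘ bump zero)} {weighted (suc v) f ∘ bump zero}
               λ { (a ∷ m) _ → refl })))
    (∑ᵐ-merge n (suc d) v (f ∘ (0 ∷_)))

-- The averaging argument over the rationals

module RationalBound where
  open MonomialSums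
  open import Data.Fin.Base using (Fin; zero; suc)
  import Data.Integer.Base as ℤ
  import Data.Integer.Properties as ℤ
  open import Data.Integer.Base using (+_)
  open import Data.Nat.Base as ℕ using (ℕ; zero; suc; _!)
  import Data.Nat.Properties as ℕ
  open import Data.Product.Base using (_,_)
  open import Data.Rational.Base as ℚ using (ℚ; 0ℚ; 1ℚ; toℚᵘ; _+_; _*_; _-_; _≤_; _<_)
  open import Data.Rational.Properties
  import Data.Rational.Unnormalised.Base as ℚᵘ
  import Data.Rational.Unnormalised.Properties as ℚᵘ
  open import Data.Rational.Solver using (module +-*-Solver)
  open import Data.Vec.Base as Vec using (Vec; lookup)
  open import Function.Base using (_∘_)
  open import Algebra.Properties.Semiring.Sum ℕ.+-*-semiring using () renaming (sum to ∑)
  open import Relation.Binary.PropositionalEquality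
  open import Relation.Nullary.Decidable using (yes; no)
  open import Relation.Nullary.Negation using (contradiction)
  open +-*-Solver

  -- Opaque, since unification would unfold the gcd in the normalisation of fractions.
  opaque
    toℚ : ℕ → ℚ
    toℚ n = + n ℚ./ 1

    toℚᵘ-toℚ : ∀ n → toℚᵘ (toℚ n) ℚᵘ.≃ ℚᵘ.mkℚᵘ (+ n) 0
    toℚᵘ-toℚ n = toℚᵘ-fromℚᵘ (ℚᵘ.mkℚᵘ (+ n) 0)

    toℚ-+ : ∀ m n → toℚ (m ℕ.+ n) ≡ toℚ m + toℚ n
    toℚ-+ m n = toℚᵘ-injective (ℚᵘ.≃-trans (toℚᵘ-toℚ (m ℕ.+ n)) (ℚᵘ.≃-sym (ℚᵘ.≃-trans
      (toℚᵘ-homo-+ (toℚ m) (toℚ n)) (ℚᵘ.≃-trans (ℚᵘ.+-cong (toℚᵘ-toℚ m) (toℚᵘ-toℚ n))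
      (ℚᵘ.*≡* (cong (ℤ._* + 1) (cong₂ ℤ._+_ (ℤ.*-identityʳ (+ m)) (ℤ.*-identityʳ (+ n)))))))))

    toℚ-* : ∀ m n → toℚ (m ℕ.* n) ≡ toℚ m * toℚ n
    toℚ-* m n = toℚᵘ-injective (ℚᵘ.≃-trans (toℚᵘ-toℚ (m ℕ.* n)) (ℚᵘ.≃-sym (ℚᵘ.≃-trans
      (toℚᵘ-homo-* (toℚ m) (toℚ n)) (ℚᵘ.≃-trans (ℚᵘ.*-cong (toℚᵘ-toℚ m) (toℚᵘ-toℚ n))
      (ℚᵘ.*≡* (cong (ℤ._* + 1) (sym (ℤ.pos-* m n))))))))

    toℚ-mono : ∀ {m n} → m ℕ.≤ n → toℚ m ≤ toℚ n
    toℚ-mono {m} {n} m≤n = toℚᵘ-cancel-≤ (ℚᵘ.≤-respʳ-≃ (ℚᵘ.≃-sym (toℚᵘ-toℚ n))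
      (ℚᵘ.≤-respˡ-≃ (ℚᵘ.≃-sym (toℚᵘ-toℚ m))
        (ℚᵘ.*≤* (ℤ.*-monoʳ-≤-nonNeg (+ 1) (ℤ.+≤+ m≤n)))))

    /1≡toℚ : ∀ n → + n ℚ./ 1 ≡ toℚ n
    /1≡toℚ n = refl

    toℚ-1 : toℚ 1 ≡ 1ℚ
    toℚ-1 = refl

    toℚ-0 : toℚ 0 ≡ 0ℚ
    toℚ-0 = refl

    toℚ-pos : ∀ n → .{{ℕ.NonZero n}} → ℚ.Positive (toℚ n)
    toℚ-pos n@(suc _) = normalize-pos n 1

  toℚ-suc : ∀ n → toℚ (suc n) ≡ toℚ n + 1ℚ
  toℚ-suc n = trans (cong toℚ (ℕ.+-comm 1 n)) (trans (toℚ-+ n 1) (cong (_+_ (toℚ n)) toℚ-1))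

  0≤toℚ : ∀ n → 0ℚ ≤ toℚ n
  0≤toℚ n = subst (_≤ toℚ n) toℚ-0 (toℚ-mono ℕ.z≤n)

  p≤q⇒0≤q-p : ∀ {p q} → p ≤ q → 0ℚ ≤ q - p
  p≤q⇒0≤q-p {p} {q} p≤q = subst (_≤ q - p) (+-inverseʳ p) (+-monoˡ-≤ (ℚ.- p) p≤q)

  -- Reduces an inequality to a polynomial identity that displays the difference as an evidently
  -- nonnegative expression.
  ≤-by : ∀ {p q s} → 0ℚ ≤ s → q - p ≡ s → p ≤ q
  ≤-by {p} {q} {s} 0≤s eq = subst₂ _≤_ (+-identityˡ p)
    (trans (cong (_+ p) (sym eq)) (solve 2 (λ p q → (q :- p) :+ p := q) refl p q))
    (+-monoˡ-≤ p 0≤s)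

  0≤+ : ∀ {p q} → 0ℚ ≤ p → 0ℚ ≤ q → 0ℚ ≤ p + q
  0≤+ = +-mono-≤

  0≤* : ∀ {p q} → 0ℚ ≤ p → 0ℚ ≤ q → 0ℚ ≤ p * q
  0≤* {p} {q} 0≤p 0≤q = subst (_≤ p * q) (*-zeroʳ p) (*-monoˡ-≤-nonNeg p {{ℚ.nonNegative 0≤p}} 0≤q)

  suc≤⇒≤ : ∀ k {p} → toℚ (suc k) ≤ p + 1ℚ → toℚ k ≤ p
  suc≤⇒≤ k {p} k+1≤ = ≤-by (p≤q⇒0≤q-p k+1≤) (trans
    (solve 2 (λ p k → p :- k := (p :+ con 1ℚ) :- (k :+ con 1ℚ)) refl p (toℚ k))
    (cong (p + 1ℚ -_) (sym (toℚ-suc k))))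

  ≤⇒≤+1 : ∀ {p q} → p ≤ q → p ≤ q + 1ℚ
  ≤⇒≤+1 {p} {q} p≤q = ≤-trans p≤q (subst (_≤ q + 1ℚ) (+-identityʳ q) (+-monoʳ-≤ q (<⇒≤ (positive⁻¹ 1ℚ))))

  ≤⇒suc≤ : ∀ k {p} → toℚ k ≤ p → toℚ (suc k) ≤ p + 1ℚ
  ≤⇒suc≤ k k≤p = ≤-trans (≤-reflexive (toℚ-suc k)) (+-monoˡ-≤ 1ℚ k≤p)

  falling : ℚ → ℕ → ℚ
  falling q zero    = 1ℚ
  falling q (suc i) = falling q i * (q - toℚ i)

  toℚ-∑-≤ : ∀ {k} A c (F G : Fin k → ℕ) → (∀ v → toℚ (A ℕ.* F v) ≤ c * toℚ (G v)) →
    toℚ (A ℕ.* ∑ F) ≤ c * toℚ (∑ G)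
  toℚ-∑-≤ {zero}  A c F G F≤G = ≤-reflexive (trans (cong toℚ (ℕ.*-zeroʳ A)) (trans toℚ-0 (sym (trans (cong (c *_) toℚ-0) (*-zeroʳ c)))))
  toℚ-∑-≤ {suc k} A c F G F≤G = begin
    toℚ (A ℕ.* (F zero ℕ.+ ∑ (F ∘ suc)))
      ≡⟨ trans (cong toℚ (ℕ.*-distribˡ-+ A (F zero) _)) (toℚ-+ (A ℕ.* F zero) _) ⟩
    toℚ (A ℕ.* F zero) + toℚ (A ℕ.* ∑ (F ∘ suc))
      ≤⟨ +-mono-≤ (F≤G zero) (toℚ-∑-≤ A c (F ∘ suc) (G ∘ suc) (F≤G ∘ suc)) ⟩
    c * toℚ (G zero) + c * toℚ (∑ (G ∘ suc))
      ≡⟨ trans (cong (c *_) (toℚ-+ (G zero) _)) (*-distribˡ-+ c _ _) ⟨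
    c * toℚ (G zero ℕ.+ ∑ (G ∘ suc)) ∎
    where open ≤-Reasoning

  -- For indicator functions f and g of families in degrees r+1 and r: whenever a member of the
  -- first family is divided by a variable, the quotient is in the second.
  ShadowIn : ∀ n (r : ℕ) (f g : Vec ℕ n → ℕ) → Set
  ShadowIn n r f g = ∀ v m → Vec.sum m ≡ r → f (bump v m) ℕ.≤ g m

  merge-shadow : ∀ {n k f g} v → ShadowIn n (suc k) f g →
    ShadowIn (suc n) k (f ∘ merge v) (g ∘ merge v)
  merge-shadow {f = f} {g} v f⊑g u m eq with merge-bump v u m
  ... | w , p rewrite p = f⊑g w (merge v m) (trans (sum-merge v m) (cong suc eq))

  -- A monomial v·m has v-exponent one more than m, and f(v·m) ≤ g(m). The exponent of m contributes
  -- D_v(g) and the extra unit contributes |g|.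
  weighted-shadow : ∀ n k f g v → ShadowIn n k f g →
    ∑ᵐ n (suc k) (weighted v f) ℕ.≤ ∑ᵐ n k g ℕ.+ ∑ᵐ n k (weighted v g)
  weighted-shadow n k f g v f⊑g = begin
    ∑ᵐ n (suc k) (weighted v f)                         ≡⟨ ∑ᵐ-weighted n k v f ⟩
    ∑ᵐ n k (λ m → suc (lookup m v) ℕ.* f (bump v m))
      ≤⟨ ∑ᵐ-mono n k (λ m eq → ℕ.*-monoʳ-≤ (suc (lookup m v)) (f⊑g v m eq)) ⟩
    ∑ᵐ n k (λ m → g m ℕ.+ weighted v g m)               ≡⟨ ∑ᵐ-+ n k g (weighted v g) ⟩
    ∑ᵐ n k g ℕ.+ ∑ᵐ n k (weighted v g)                   ∎
    where open ℕ.≤-Reasoning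

  -- The case of a variable of large weighted degree D: the trivial bound D′ ≤ h + D suffices.
  large-degree : ∀ (k h D D′ : ℕ) q F → toℚ k ≤ q →
    toℚ (suc k !) * toℚ h ≤ F * (q - toℚ k) → F ≤ toℚ (k !) * toℚ D → D′ ℕ.≤ h ℕ.+ D →
    toℚ (suc k ℕ.* D′) ≤ (q + 1ℚ) * toℚ D
  large-degree k h D D′ q F k≤q h≤ F≤ D′≤ =
    -- After multiplication by k! the difference of the two sides is a sum of three terms, each the
    -- slack of a hypothesis times a nonnegative factor.
    *-cancelˡ-≤-pos t {{toℚ-pos (k !) {{k ℕ.!≢0}}}} (≤-by
      (0≤+ (0≤+ (0≤* (0≤toℚ (suc k !)) (p≤q⇒0≤q-p (toℚ-mono D′≤))) (p≤q⇒0≤q-p h≤))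
           (0≤* (p≤q⇒0≤q-p F≤) (p≤q⇒0≤q-p k≤q)))
      (identity (toℚ (suc k !)) (toℚ (h ℕ.+ D)) (toℚ (suc k ℕ.* D′))
        (trans (toℚ-* (suc k) (k !)) (cong (_* t) (toℚ-suc k))) (toℚ-+ h D)
        (trans (toℚ-* (suc k) D′) (cong (_* toℚ D′) (toℚ-suc k)))))
    where
    t = toℚ (k !)
    identity : ∀ t′ s d → t′ ≡ (toℚ k + 1ℚ) * t → s ≡ toℚ h + toℚ D → d ≡ (toℚ k + 1ℚ) * toℚ D′ →
      t * ((q + 1ℚ) * toℚ D) - t * d ≡
      (t′ * (s - toℚ D′) + (F * (q - toℚ k) - t′ * toℚ h)) + (t * toℚ D - F) * (q - toℚ k)
    identity _ _ _ refl refl refl = solve 7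
      (λ K h D D′ q F t → t :* ((q :+ con 1ℚ) :* D) :- t :* ((K :+ con 1ℚ) :* D′) :=
        ((K :+ con 1ℚ) :* t :* ((h :+ D) :- D′) :+ (F :* (q :- K) :- (K :+ con 1ℚ) :* t :* h))
        :+ (t :* D :- F) :* (q :- K))
      refl (toℚ k) (toℚ h) (toℚ D) (toℚ D′) q F t

  -- Here r is `suc k`, and the factorial form of the hypothesis says |g| ≤ C(q,r). In the mutual
  -- recursion k decreases, while each merging adds a variable.
  shadow-bound   : ∀ n k f g q → toℚ k ≤ q → ShadowIn n (suc k) f g →
    toℚ (suc k !) * toℚ (∑ᵐ n (suc k) g) ≤ falling q (suc k) →
    toℚ (suc (suc k) ℕ.* ∑ᵐ n (suc (suc k)) f) ≤ (q + 1ℚ) * toℚ (∑ᵐ n (suc k) g)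
  -- For k = 0 the strict hypothesis says that g vanishes; a weak one would not suffice.
  shadow-bound-< : ∀ n k f g q → toℚ k ≤ q + 1ℚ → ShadowIn n k f g →
    toℚ (k !) * toℚ (∑ᵐ n k g) < falling q k →
    toℚ (suc k ℕ.* ∑ᵐ n (suc k) f) ≤ (q + 1ℚ) * toℚ (∑ᵐ n k g)

  -- The factor `suc k` is the degree of g: summing D_v(g) over v produces it on the right, and the
  -- inequality for each v carries it on the left.
  shadow-bound n k f g q k≤q f⊑g g≤ = *-cancelˡ-≤-pos (toℚ (suc k)) {{toℚ-pos (suc k)}} (begin
    toℚ (suc k) * toℚ (suc (suc k) ℕ.* ∑ᵐ n (suc (suc k)) f)
      ≡⟨ toℚ-* (suc k) _ ⟨
    toℚ (suc k ℕ.* (suc (suc k) ℕ.* ∑ᵐ n (suc (suc k)) f))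
      ≡⟨ cong (λ s → toℚ (suc k ℕ.* s)) (∑-weighted n (suc (suc k)) f) ⟨
    toℚ (suc k ℕ.* ∑ (λ v → ∑ᵐ n (suc (suc k)) (weighted v f)))
      ≤⟨ toℚ-∑-≤ (suc k) (q + 1ℚ) _ _ each ⟩
    (q + 1ℚ) * toℚ (∑ (λ v → ∑ᵐ n (suc k) (weighted v g)))
      ≡⟨ cong (λ s → (q + 1ℚ) * toℚ s) (∑-weighted n (suc k) g) ⟩
    (q + 1ℚ) * toℚ (suc k ℕ.* ∑ᵐ n (suc k) g)
      ≡⟨ cong ((q + 1ℚ) *_) (toℚ-* (suc k) _) ⟩
    (q + 1ℚ) * (toℚ (suc k) * toℚ (∑ᵐ n (suc k) g))
      ≡⟨ solve 3 (λ a b c → a :* (b :* c) := b :* (a :* c)) refl (q + 1ℚ) (toℚ (suc k)) _ ⟩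
    toℚ (suc k) * ((q + 1ℚ) * toℚ (∑ᵐ n (suc k) g)) ∎)
    where
    open ≤-Reasoning
    each : ∀ v → toℚ (suc k ℕ.* ∑ᵐ n (suc (suc k)) (weighted v f)) ≤ (q + 1ℚ) * toℚ (∑ᵐ n (suc k) (weighted v g))
    each v with toℚ (k !) * toℚ (∑ᵐ n (suc k) (weighted v g)) <? falling q k
    ... | no  ≮ = large-degree k (∑ᵐ n (suc k) g) _ _ q (falling q k) k≤q g≤ (≮⇒≥ ≮)
      (weighted-shadow n (suc k) f g v f⊑g)
    -- D_v(g) and D_v(f) become plain sums over families of degrees k and k+1 in one more variable,
    -- with the same q.
    ... | yes < rewrite sym (∑ᵐ-merge n k v g) | sym (∑ᵐ-merge n (suc k) v f) =
      shadow-bound-< (suc n) k (f ∘ merge v) (g ∘ merge v) q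
        (≤⇒≤+1 k≤q)
        (merge-shadow {f = f} {g} v f⊑g) <

  shadow-bound-< n zero f g q 0≤q+1 f⊑g g< = ≤-trans
    -- In degree one |f| is the sum of the D_v(f), and each is at most |g| + D_v(g). Both terms
    -- vanish, the second because degree zero leaves no exponent.
    (toℚ-mono (ℕ.≤-trans (ℕ.≤-reflexive (sym (∑-weighted n 1 f))) (∑-≤0 _ λ v →
      ℕ.≤-trans (weighted-shadow n 0 f g v f⊑g)
                (ℕ.≤-reflexive (cong₂ ℕ._+_ (toℚ<1 _ g<) (∑ᵐ-weighted-zero n v g))))))
    (≤-trans (≤-reflexive toℚ-0) (0≤* (≤-trans (0≤toℚ 0) 0≤q+1) (0≤toℚ _)))
    where
    toℚ<1 : ∀ h → toℚ 1 * toℚ h < 1ℚ → h ≡ 0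
    toℚ<1 zero    _  = refl
    toℚ<1 (suc h) h< = contradiction (<-≤-trans h<
      (≤-trans (≤-trans (≤-reflexive (sym toℚ-1)) (toℚ-mono {1} {suc h} (ℕ.s≤s ℕ.z≤n)))
        (≤-reflexive (sym (trans (cong (_* toℚ (suc h)) toℚ-1) (*-identityˡ _))))))
      (<-irrefl refl)
    ∑-≤0 : ∀ {k} (F : Fin k → ℕ) → (∀ v → F v ℕ.≤ 0) → ∑ F ℕ.≤ 0
    ∑-≤0 {zero}  F F≤0 = ℕ.z≤n
    ∑-≤0 {suc k} F F≤0 = ℕ.+-mono-≤ (F≤0 zero) (∑-≤0 (F ∘ suc) (F≤0 ∘ suc))
  shadow-bound-< n (suc k) f g q k≤q f⊑g g< =
    shadow-bound n k f g q (suc≤⇒≤ k {q} k≤q) f⊑g (<⇒≤ g<)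

-- From rational estimates to real binomial coefficients

module RealBounds where
  open RationalBound
  open import Data.Integer.Base using (+_)
  open import Data.Nat.Base as ℕ using (ℕ; zero; suc; _!)
  import Data.Nat.Properties as ℕ
  open import Data.Product.Base using (∃; _×_; _,_)
  open import Data.Rational.Base as ℚ using (ℚ; 0ℚ; 1ℚ; _+_; _*_; _-_; _≤_; _<_; 1/_; ∣_∣)
  open import Data.Rational.Properties
  import Data.Rational.Unnormalised.Base as ℚᵘ
  import Data.Rational.Unnormalised.Properties as ℚᵘ
  open import Data.Rational.Solver using (module +-*-Solver)
  open import Data.Sum.Base using (inj₁; inj₂)
  open import Relation.Binary.PropositionalEquality
  open import Relation.Nullary.Decidable using (yes; no)
  open import Relation.Nullary.Negation using (contradiction)
  open +-*-Solver

  *-mono-≤-nonNeg : ∀ {p q r s} → 0ℚ ≤ p → 0ℚ ≤ s → p ≤ q → r ≤ s → p * r ≤ q * s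
  *-mono-≤-nonNeg {p} {q} {r} {s} 0≤p 0≤s p≤q r≤s = ≤-trans
    (*-monoˡ-≤-nonNeg p {{ℚ.nonNegative 0≤p}} r≤s) (*-monoʳ-≤-nonNeg s {{ℚ.nonNegative 0≤s}} p≤q)

  falling-nonNeg : ∀ k {q} → toℚ k ≤ q + 1ℚ → 0ℚ ≤ falling q k
  falling-nonNeg zero    k≤   = <⇒≤ (positive⁻¹ 1ℚ)
  falling-nonNeg (suc k) {q} k+1≤ = 0≤* (falling-nonNeg k (≤⇒≤+1 k≤q)) (p≤q⇒0≤q-p k≤q)
    where k≤q = suc≤⇒≤ k {q} k+1≤

  -- Since q ≥ k-1, the first k factors are nonnegative and only the last, q-k, has the opposite
  -- sign.
  falling-nonPos : ∀ k {q} → toℚ k ≤ q + 1ℚ → q ≤ toℚ k → falling q (suc k) ≤ 0ℚ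
  falling-nonPos k {q} k≤q+1 q≤k = ≤-by (0≤* (falling-nonNeg k k≤q+1) (p≤q⇒0≤q-p q≤k))
    (solve 3 (λ f q k → con 0ℚ :- f :* (q :- k) := f :* (k :- q)) refl (falling q k) q (toℚ k))

  falling-mono : ∀ k {p q} → toℚ k ≤ p + 1ℚ → p ≤ q → falling p k ≤ falling q k
  falling-mono zero    k≤   p≤q = ≤-refl
  falling-mono (suc k) k+1≤ p≤q = *-mono-≤-nonNeg (falling-nonNeg k k≤p+1)
    (p≤q⇒0≤q-p (≤-trans k≤p p≤q)) (falling-mono k k≤p+1 p≤q) (+-monoˡ-≤ (ℚ.- toℚ k) p≤q)
    where
    k≤p   = suc≤⇒≤ k k+1≤
    k≤p+1 = ≤⇒≤+1 k≤p

  -- p may lie slightly to the left of k, where the falling factorial is negative.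
  falling-suc-mono : ∀ k {p q} → toℚ k ≤ p + 1ℚ → toℚ k ≤ q → p ≤ q →
    falling p (suc k) ≤ falling q (suc k)
  falling-suc-mono k {p} {q} k≤p+1 k≤q p≤q with ≤-total p (toℚ k)
  ... | inj₁ p≤k = ≤-trans (falling-nonPos k k≤p+1 p≤k) (falling-nonNeg (suc k) (≤⇒suc≤ k k≤q))
  ... | inj₂ k≤p = falling-mono (suc k) (≤⇒suc≤ k k≤p) p≤q

  -- The recursion splits off the last factor; the induction moves the first one, q+1, to the front.
  falling-shift : ∀ q k → falling (q + 1ℚ) (suc k) ≡ (q + 1ℚ) * falling q k
  falling-shift q zero = trans (cong (λ z → 1ℚ * (q + 1ℚ - z)) toℚ-0)
    (solve 1 (λ q → con 1ℚ :* (q :+ con 1ℚ :- con 0ℚ) := (q :+ con 1ℚ) :* con 1ℚ) refl q)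
  falling-shift q (suc k) = trans
    (cong₂ (λ f z → f * (q + 1ℚ - z)) (falling-shift q k) (toℚ-suc k))
    (solve 3 (λ q k f → (q :+ con 1ℚ) :* f :* (q :+ con 1ℚ :- (k :+ con 1ℚ)) :=
                        (q :+ con 1ℚ) :* (f :* (q :- k))) refl q (toℚ k) (falling q k))

  toℚ-*-1/ : ∀ n .{{_ : ℕ.NonZero n}} → toℚ n * (+ 1 ℚ./ n) ≡ 1ℚ
  toℚ-*-1/ n@(suc n-1) = toℚᵘ-injective (ℚᵘ.≃-trans (toℚᵘ-homo-* (toℚ n) (+ 1 ℚ./ n))
    (ℚᵘ.≃-trans (ℚᵘ.*-cong (toℚᵘ-toℚ n) (toℚᵘ-fromℚᵘ (ℚᵘ.mkℚᵘ (+ 1) n-1)))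
      (ℚᵘ.*≡* (cong +_ (trans (ℕ.*-identityʳ (n ℕ.* 1)) (trans (ℕ.*-comm n 1) (sym (ℕ.*-identityˡ (1 ℕ.* n)))))))))

  opaque
    1/! : ℕ → ℚ
    1/! i = (+ 1 ℚ./ i !) {{i ℕ.!≢0}}

    !*1/! : ∀ i → toℚ (i !) * 1/! i ≡ 1ℚ
    !*1/! i = toℚ-*-1/ (i !) {{i ℕ.!≢0}}

    binomial-seq : ∀ x i n → seq (binomial x i) n ≡ falling (seq x n) i * 1/! i
    binomial-seq x i n = cong (_* 1/! i) (fallingFactorial-seq i)
      where
      fallingFactorial-seq : ∀ i → seq (fallingFactorial x i) n ≡ falling (seq x n) i
      fallingFactorial-seq zero    = refl
      fallingFactorial-seq (suc i) = cong₂ _*_ (fallingFactorial-seq i) (cong (seq x n -_) (/1≡toℚ i))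

  1/!-suc : ∀ k → toℚ (suc k) * 1/! (suc k) ≡ 1/! k
  1/!-suc k = begin
    toℚ (suc k) * 1/! (suc k)                            ≡⟨ *-identityˡ _ ⟨
    1ℚ * (toℚ (suc k) * 1/! (suc k))                     ≡⟨ cong (_* (toℚ (suc k) * 1/! (suc k))) (!*1/! k) ⟨
    (toℚ (k !) * 1/! k) * (toℚ (suc k) * 1/! (suc k))
      ≡⟨ solve 4 (λ a b c d → (a :* b) :* (c :* d) := ((c :* a) :* d) :* b) refl (toℚ (k !)) (1/! k) (toℚ (suc k)) _ ⟩
    ((toℚ (suc k) * toℚ (k !)) * 1/! (suc k)) * 1/! k
      ≡⟨ cong (λ z → (z * 1/! (suc k)) * 1/! k) (toℚ-* (suc k) (k !)) ⟨
    (toℚ (suc k !) * 1/! (suc k)) * 1/! k                ≡⟨ cong (_* 1/! k) (!*1/! (suc k)) ⟩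
    1ℚ * 1/! k                                           ≡⟨ *-identityˡ _ ⟩
    1/! k                                                ∎
    where open ≡-Reasoning

  toℚ-!-pos : ∀ i → ℚ.Positive (toℚ (i !))
  toℚ-!-pos i = toℚ-pos (i !) {{i ℕ.!≢0}}

  1/!-nonNeg : ∀ i → ℚ.NonNegative (1/! i)
  1/!-nonNeg i = ℚ.nonNegative (*-cancelˡ-≤-pos (toℚ (i !)) {{toℚ-!-pos i}}
    (subst₂ _≤_ (sym (*-zeroʳ (toℚ (i !)))) (sym (!*1/! i)) (<⇒≤ (positive⁻¹ 1ℚ))))

  !*≤ : ∀ i h q → toℚ h ≤ falling q i * 1/! i → toℚ (i !) * toℚ h ≤ falling q i
  !*≤ i h q h≤ = ≤-trans (*-monoˡ-≤-nonNeg (toℚ (i !)) {{pos⇒nonNeg (toℚ (i !)) {{toℚ-!-pos i}}}} h≤)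
    (≤-reflexive (trans (solve 3 (λ a b c → a :* (b :* c) := b :* (a :* c)) refl (toℚ (i !)) (falling q i) (1/! i))
      (trans (cong (falling q i *_) (!*1/! i)) (*-identityʳ _))))

  divide : ∀ M → 0ℚ < M → ∀ {ε} → 0ℚ < ε → ∃ λ δ → 0ℚ < δ × M * δ ≡ ε
  divide M 0<M {ε} 0<ε = (1/ M) * ε
    , subst (_< (1/ M) * ε) (*-zeroʳ (1/ M)) (*-monoʳ-<-pos (1/ M) 0<ε)
    , trans (sym (*-assoc M (1/ M) ε)) (trans (cong (_* ε) (*-inverseʳ M)) (*-identityˡ ε))
    where
    instance
      _ = ℚ.positive 0<M
      _ = pos⇒nonZero M
      _ = 1/pos⇒pos M

  ≤+ε⇒≤ : ∀ {p q} → (∀ ε → 0ℚ < ε → p ≤ q + ε) → p ≤ q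
  ≤+ε⇒≤ {p} {q} p≤q+ with p ≤? q
  ... | yes p≤q = p≤q
  ... | no  p≰q with <-dense (≰⇒> p≰q)
  ...   | m , q<m , m<p = contradiction
    (≤-<-trans (p≤q+ (m - q) (subst (_< m - q) (+-inverseʳ q) (+-monoˡ-< (ℚ.- q) q<m)))
      (subst (_< p) (solve 2 (λ m q → m := q :+ (m :- q)) refl m q) m<p))
    (<-irrefl refl)

  p≤∣p∣ : ∀ p → p ≤ ∣ p ∣
  p≤∣p∣ p with ≤-total 0ℚ p
  ... | inj₁ 0≤p = ≤-reflexive (sym (0≤p⇒∣p∣≡p 0≤p))
  ... | inj₂ p≤0 = ≤-trans p≤0 (0≤∣p∣ p)

  ∣p-q∣≤⇒p≤ : ∀ {p q ε} → ∣ p - q ∣ ≤ ε → p ≤ q + ε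
  ∣p-q∣≤⇒p≤ {p} {q} {ε} ≤ε = ≤-by (p≤q⇒0≤q-p (≤-trans (p≤∣p∣ (p - q)) ≤ε))
    (solve 3 (λ p q e → q :+ e :- p := e :- (p :- q)) refl p q ε)

  ∣p-q∣≤⇒q≤ : ∀ {p q ε} → ∣ p - q ∣ ≤ ε → q ≤ p + ε
  ∣p-q∣≤⇒q≤ {p} {q} {ε} ≤ε = ∣p-q∣≤⇒p≤ (subst (_≤ ε)
    (trans (sym (∣-p∣≡∣p∣ (p - q))) (cong ∣_∣ (solve 2 (λ p q → :- (p :- q) := q :- p) refl p q))) ≤ε)

  choose : ℚ → ℕ → ℚ
  choose q i = falling q i * 1/! i

  -- The absorption identity, which turns the factor q+1 of the combinatorial bound into a shift of
  -- the binomial coefficient.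
  choose-shift : ∀ q k → toℚ (suc k) * choose (q + 1ℚ) (suc k) ≡ (q + 1ℚ) * choose q k
  choose-shift q k = trans
    (cong (λ f → toℚ (suc k) * (f * 1/! (suc k))) (falling-shift q k))
    (trans (solve 4 (λ K q f c → K :* ((q :* f) :* c) := q :* (f :* (K :* c))) refl
              (toℚ (suc k)) (q + 1ℚ) (falling q k) (1/! (suc k)))
           (cong (λ c → (q + 1ℚ) * (falling q k * c)) (1/!-suc k)))

  choose-mono : ∀ k {p q} → toℚ k ≤ p + 1ℚ → toℚ k ≤ q → p ≤ q → choose p (suc k) ≤ choose q (suc k)
  choose-mono k k≤p+1 k≤q p≤q =
    *-monoʳ-≤-nonNeg (1/! (suc k)) {{1/!-nonNeg (suc k)}} (falling-suc-mono k k≤p+1 k≤q p≤q)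

  -- Replacing h by C(a,k) + δ and a + δ by a costs at most (a+1+h)δ in a bound for (k+1)h′.
  -- Division by k+1 leaves no more than (B+h)δ.
  upper-estimate : ∀ k a δ B h h′ → 0ℚ ≤ a + 1ℚ → a + 1ℚ ≤ B → 0ℚ ≤ (B + toℚ h) * δ → 0ℚ ≤ δ →
    toℚ h ≤ choose a k + δ → toℚ (suc k ℕ.* h′) ≤ (a + δ + 1ℚ) * toℚ h →
    toℚ h′ ≤ choose (a + 1ℚ) (suc k) + (B + toℚ h) * δ
  upper-estimate k a δ B h h′ 0≤a+1 a+1≤B 0≤ε 0≤δ h≤ h′≤ =
    *-cancelˡ-≤-pos (toℚ (suc k)) {{toℚ-pos (suc k)}} (≤-by
      (0≤+ (0≤+ (p≤q⇒0≤q-p h′≤) (0≤* 0≤a+1 (p≤q⇒0≤q-p h≤)))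
           (0≤+ (0≤* (p≤q⇒0≤q-p a+1≤B) 0≤δ) (0≤* (0≤toℚ k) 0≤ε)))
      (identity _ _ _ (choose-shift a k) (toℚ-suc k) (toℚ-* (suc k) h′)))
    where
    identity : ∀ c R s → R * c ≡ (a + 1ℚ) * choose a k → R ≡ toℚ k + 1ℚ → s ≡ R * toℚ h′ →
      R * (c + (B + toℚ h) * δ) - R * toℚ h′ ≡
      ((a + δ + 1ℚ) * toℚ h - s + (a + 1ℚ) * (choose a k + δ - toℚ h)) +
      ((B - (a + 1ℚ)) * δ + toℚ k * ((B + toℚ h) * δ))
    identity c R s Rc refl refl = trans
      (trans (cong (_- R * toℚ h′) (*-distribˡ-+ R c _)) (cong (λ z → z + R * ((B + toℚ h) * δ) - R * toℚ h′) Rc))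
      (solve 7 (λ a d B h h′ K b →
        (a :+ con 1ℚ) :* b :+ (K :+ con 1ℚ) :* ((B :+ h) :* d) :- (K :+ con 1ℚ) :* h′ :=
        ((a :+ d :+ con 1ℚ) :* h :- (K :+ con 1ℚ) :* h′ :+ (a :+ con 1ℚ) :* (b :+ d :- h)) :+
        ((B :- (a :+ con 1ℚ)) :* d :+ K :* ((B :+ h) :* d)))
        refl a δ B (toℚ h) (toℚ h′) (toℚ k) (choose a k))

  -- By absorption, (q+1) C(q,k) ≤ (k+1)(h′+η) ≤ (q+1)h + (k+1)η. Dividing by q+1 ≥ 1 does not
  -- enlarge the error.
  lower-estimate : ∀ k q η h h′ → 0ℚ ≤ toℚ (suc k) * η →
    choose (q + 1ℚ) (suc k) ≤ toℚ h′ + η → toℚ (suc k ℕ.* h′) ≤ (q + 1ℚ) * toℚ h → 1ℚ ≤ q + 1ℚ →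
    choose q k ≤ toℚ h + toℚ (suc k) * η
  lower-estimate k q η h h′ 0≤ε ≤h′ h′≤ 1≤q+1 =
    *-cancelˡ-≤-pos (q + 1ℚ) {{ℚ.positive (<-≤-trans (positive⁻¹ 1ℚ) 1≤q+1)}} (≤-by
      (0≤+ (0≤+ (p≤q⇒0≤q-p h′≤) (0≤* (0≤toℚ (suc k)) (p≤q⇒0≤q-p ≤h′)))
           (0≤* (p≤q⇒0≤q-p 1≤q+1) 0≤ε))
      (identity _ _ (choose-shift q k) (toℚ-* (suc k) h′)))
    where
    R = toℚ (suc k)
    identity : ∀ c s → R * c ≡ (q + 1ℚ) * choose q k → s ≡ R * toℚ h′ →
      (q + 1ℚ) * (toℚ h + R * η) - (q + 1ℚ) * choose q k ≡
      ((q + 1ℚ) * toℚ h - s + R * (toℚ h′ + η - c)) + (q + 1ℚ - 1ℚ) * (R * η)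
    identity c s Rc refl = trans (cong ((q + 1ℚ) * (toℚ h + R * η) -_) (sym Rc))
      (solve 6 (λ Q h R η h′ c → Q :* (h :+ R :* η) :- R :* c :=
        (Q :* h :- R :* h′ :+ R :* (h′ :+ η :- c)) :+ (Q :- con 1ℚ) :* (R :* η))
        refl (q + 1ℚ) (toℚ h) R η (toℚ h′) c)

  -- With r = `suc k`: if h_r ≤ C(q,r) then (r+1) h_{r+1} ≤ (q+1) h_r. Keeping h_r on the right,
  -- rather than C(q,r), lets the same bound also estimate h_r from below.
  MacaulayBound : (ℕ → ℕ) → Set
  MacaulayBound h = ∀ k q → toℚ k ≤ q → toℚ (suc k !) * toℚ (h (suc k)) ≤ falling q (suc k) →
    toℚ (suc (suc k) ℕ.* h (suc (suc k))) ≤ (q + 1ℚ) * toℚ (h (suc k))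

  -- The two inequalities for a real number x

  module _ (h : ℕ → ℕ) (bound : MacaulayBound h) (x : ℝ) where
    open ≤-Reasoning

    ≤ℝ-seq : ∀ k → fromℕ k ≤ℝ x → ∀ ε → 0ℚ < ε → ∃ λ N → ∀ n → N ℕ.≤ n → toℚ k ≤ seq x n + ε
    ≤ℝ-seq k k≤x ε 0<ε = let N , p = k≤x ε 0<ε in N , λ n n≥ → subst (_≤ seq x n + ε) (/1≡toℚ k) (p n n≥)

    ≈ℝ-seq : ∀ k → fromℕ (h k) ≈ℝ binomial x k → ∀ ε → 0ℚ < ε →
      ∃ λ N → ∀ n → N ℕ.≤ n → ∣ toℚ (h k) - choose (seq x n) k ∣ ≤ ε
    ≈ℝ-seq k h≈ ε 0<ε = let N , p = h≈ ε 0<ε in N , λ n n≥ →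
      subst₂ (λ u v → ∣ u - v ∣ ≤ ε) (/1≡toℚ (h k)) (binomial-seq x k n) (p n n≥)

    -- A term a of the sequence of x may lie below k, and C(a, k+1) may lie below h(k+1). The bound
    -- is therefore applied at a + δ, which repairs both defects.
    next-≤ : ∀ k → fromℕ k ≤ℝ x → fromℕ (h (suc k)) ≈ℝ binomial x (suc k) →
      fromℕ (h (suc (suc k))) ≤ℝ binomial (x +ℝ fromℕ 1) (suc (suc k))
    next-≤ k k≤x h≈ ε 0<ε =
      let
        N₁ , x≈   = cauchy x 1ℚ 0<1
        -- From `N₁` on, terms of x exceed `seq x N₁` by at most 1, so B bounds a + 1.
        B         = ∣ seq x N₁ ∣ + 1ℚ + 1ℚ
        H         = toℚ (h (suc k))
        0<M       = <-≤-trans 0<1 (≤-by (0≤+ (0≤+ (0≤∣p∣ (seq x N₁)) (<⇒≤ 0<1)) (0≤toℚ (h (suc k))))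
                      (solve 2 (λ u v → u :+ con 1ℚ :+ con 1ℚ :+ v :- con 1ℚ := u :+ con 1ℚ :+ v)
                        refl ∣ seq x N₁ ∣ H))
        -- Makes the error term of `upper-estimate` equal to ε.
        δ , 0<δ , Mδ≡ε = divide (B + H) 0<M 0<ε
        N₂ , x≈δ  = cauchy x δ 0<δ
        N₃ , k≤+1 = ≤ℝ-seq k k≤x 1ℚ 0<1
        N₄ , k≤+δ = ≤ℝ-seq k k≤x δ 0<δ
        N₅ , h≈δ  = ≈ℝ-seq (suc k) h≈ δ 0<δ
        N         = N₁ ℕ.⊔ (N₂ ℕ.⊔ (N₃ ℕ.⊔ (N₄ ℕ.⊔ N₅)))
      in N , λ n n≥ →
      let
        n≥₁ = ℕ.m⊔n≤o⇒m≤o N₁ _ n≥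
        r₁  = ℕ.m⊔n≤o⇒n≤o N₁ _ n≥
        n≥₂ = ℕ.m⊔n≤o⇒m≤o N₂ _ r₁
        r₂  = ℕ.m⊔n≤o⇒n≤o N₂ _ r₁
        n≥₃ = ℕ.m⊔n≤o⇒m≤o N₃ _ r₂
        r₃  = ℕ.m⊔n≤o⇒n≤o N₃ _ r₂
        n≥₄ = ℕ.m⊔n≤o⇒m≤o N₄ _ r₃
        n≥₅ = ℕ.m⊔n≤o⇒n≤o N₄ _ r₃
        a   = seq x n
        q   = a + δ
        -- An exact inequality, obtained from later terms of x: they stay below a + δ, while their
        -- binomial coefficients come within any η of H.
        H≤ : H ≤ choose q (suc k)
        H≤ = ≤+ε⇒≤ λ η 0<η →
          let N₆ , h≈η = ≈ℝ-seq (suc k) h≈ η 0<η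
              m = n ℕ.⊔ N₆
              n≤m = ℕ.m≤m⊔n n N₆
          in ≤-trans (∣p-q∣≤⇒p≤ (h≈η m (ℕ.m≤n⊔m n N₆)))
               (+-monoˡ-≤ η (choose-mono k (k≤+1 m (ℕ.≤-trans n≥₃ n≤m)) (k≤+δ n n≥₄)
                 (∣p-q∣≤⇒p≤ (x≈δ m n (ℕ.≤-trans n≥₂ n≤m) n≥₂))))
      in begin
        seq (fromℕ (h (suc (suc k)))) n        ≡⟨ /1≡toℚ (h (suc (suc k))) ⟩
        toℚ (h (suc (suc k)))
          ≤⟨ upper-estimate (suc k) a δ B (h (suc k)) (h (suc (suc k)))
               (≤-trans (0≤toℚ k) (k≤+1 n n≥₃))
               (+-monoˡ-≤ 1ℚ (≤-trans (∣p-q∣≤⇒p≤ {a} {seq x N₁} (x≈ n N₁ n≥₁ ℕ.≤-refl)) (+-monoˡ-≤ 1ℚ (p≤∣p∣ (seq x N₁)))))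
               (≤-trans (<⇒≤ 0<ε) (≤-reflexive (sym Mδ≡ε))) (<⇒≤ 0<δ)
               (∣p-q∣≤⇒p≤ (h≈δ n n≥₅))
               (bound k q (k≤+δ n n≥₄) (!*≤ (suc k) (h (suc k)) q H≤)) ⟩
        choose (a + 1ℚ) (suc (suc k)) + (B + H) * δ
          ≡⟨ cong₂ _+_ (trans (binomial-seq (x +ℝ fromℕ 1) (suc (suc k)) n)
               (cong (λ z → choose (a + z) (suc (suc k))) (trans (/1≡toℚ 1) toℚ-1))) (sym Mδ≡ε) ⟨
        seq (binomial (x +ℝ fromℕ 1) (suc (suc k))) n + ε ∎
      where
      0<1 = positive⁻¹ 1ℚ

    -- The claim is immediate when C(q, k+1) is nonpositive or at most h(k+1). Otherwise h(k+1) ≤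
    -- C(q, k+1), which is what the growth bound requires.
    choose-previous : ∀ k q η → toℚ k ≤ q + 1ℚ → 0ℚ ≤ toℚ (suc (suc k)) * η →
      choose (q + 1ℚ) (suc (suc k)) ≤ toℚ (h (suc (suc k))) + η →
      choose q (suc k) ≤ toℚ (h (suc k)) + toℚ (suc (suc k)) * η
    choose-previous k q η k≤q+1 0≤ε ≤h′ with ≤-total q (toℚ k)
    ... | inj₁ q≤k = ≤-trans
      (*-monoʳ-≤-nonNeg (1/! (suc k)) {{1/!-nonNeg (suc k)}} (falling-nonPos k k≤q+1 q≤k))
      (≤-trans (≤-reflexive (*-zeroˡ (1/! (suc k)))) (0≤+ (0≤toℚ (h (suc k))) 0≤ε))
    ... | inj₂ k≤q with ≤-total (choose q (suc k)) (toℚ (h (suc k)))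
    ...   | inj₁ ≤h = ≤-trans ≤h
      (≤-trans (≤-reflexive (sym (+-identityʳ _))) (+-monoʳ-≤ (toℚ (h (suc k))) 0≤ε))
    ...   | inj₂ h≤ = lower-estimate (suc k) q η (h (suc k)) (h (suc (suc k))) 0≤ε ≤h′
      (bound k q k≤q (!*≤ (suc k) (h (suc k)) q h≤))
      (+-monoˡ-≤ 1ℚ (≤-trans (0≤toℚ k) k≤q))

    previous-≥ : ∀ k → fromℕ (suc k) ≤ℝ x → fromℕ (h (suc (suc k))) ≈ℝ binomial x (suc (suc k)) →
      binomial (x -ℝ fromℕ 1) (suc k) ≤ℝ fromℕ (h (suc k))
    previous-≥ k k+1≤x h≈ ε 0<ε =
      let
        R = toℚ (suc (suc k))
        -- The error is magnified by R in `choose-previous`, so it is divided by R beforehand.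
        η , 0<η , Rη≡ε = divide R (positive⁻¹ R {{toℚ-pos (suc (suc k))}}) 0<ε
        N₁ , k+1≤+1 = ≤ℝ-seq (suc k) k+1≤x 1ℚ (positive⁻¹ 1ℚ)
        N₂ , h≈η    = ≈ℝ-seq (suc (suc k)) h≈ η 0<η
      in N₁ ℕ.⊔ N₂ , λ n n≥ →
      let
        a     = seq x n
        a-1+1 : a ≡ a - 1ℚ + 1ℚ
        a-1+1 = solve 1 (λ a → a := a :- con 1ℚ :+ con 1ℚ) refl a
      in begin
        seq (binomial (x -ℝ fromℕ 1) (suc k)) n
          ≡⟨ trans (binomial-seq (x -ℝ fromℕ 1) (suc k) n)
               (cong (λ z → choose (a - z) (suc k)) (trans (/1≡toℚ 1) toℚ-1)) ⟩
        choose (a - 1ℚ) (suc k)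
          ≤⟨ choose-previous k (a - 1ℚ) η
               (subst (toℚ k ≤_) a-1+1 (suc≤⇒≤ k (k+1≤+1 n (ℕ.m⊔n≤o⇒m≤o N₁ N₂ n≥))))
               (≤-trans (<⇒≤ 0<ε) (≤-reflexive (sym Rη≡ε)))
               (subst (λ z → choose z (suc (suc k)) ≤ toℚ (h (suc (suc k))) + η) a-1+1
                 (∣p-q∣≤⇒q≤ {toℚ (h (suc (suc k)))} (h≈η n (ℕ.m⊔n≤o⇒n≤o N₁ N₂ n≥)))) ⟩
        toℚ (h (suc k)) + R * η             ≡⟨ cong₂ _+_ (/1≡toℚ (h (suc k))) (sym Rη≡ε) ⟨
        seq (fromℕ (h (suc k))) n + ε       ∎

    -- The case r = 1, where the binomial coefficient is 1.
    previous-≥-zero : 1 ℕ.≤ h 0 → binomial (x -ℝ fromℕ 1) 0 ≤ℝ fromℕ (h 0)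
    previous-≥-zero 1≤h ε 0<ε = 0 , λ n _ → begin
      seq (binomial (x -ℝ fromℕ 1) 0) n     ≡⟨ binomial-seq (x -ℝ fromℕ 1) 0 n ⟩
      1ℚ * 1/! 0                            ≡⟨ cong (_* 1/! 0) toℚ-1 ⟨
      toℚ (0 !) * 1/! 0                     ≡⟨ !*1/! 0 ⟩
      1ℚ                                    ≡⟨ toℚ-1 ⟨
      toℚ 1                                 ≤⟨ toℚ-mono 1≤h ⟩
      toℚ (h 0)                             ≡⟨ +-identityʳ _ ⟨
      toℚ (h 0) + 0ℚ                        ≤⟨ +-monoʳ-≤ (toℚ (h 0)) (<⇒≤ 0<ε) ⟩
      toℚ (h 0) + ε                         ≡⟨ cong (_+ ε) (/1≡toℚ (h 0)) ⟨
      seq (fromℕ (h 0)) n + ε               ∎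

-- Spans, independence and the exchange bound

module LinearAlgebra where
  open import Level using (Level; _⊔_)
  open import Algebra.Apartness.Bundles using (HeytingField; HeytingCommutativeRing)
  open import Algebra.Bundles using (CommutativeRing)
  open import Algebra.Morphism.Structures using (IsRingHomomorphism)
  import Algebra.Properties.Ring as RingProperties
  open import Data.Fin.Base using (Fin; zero; suc)
  open import Data.List.Base as List using (List; []; _∷_; length)
  open import Data.List.Relation.Unary.All as All using (All; []; _∷_)
  open import Data.Nat.Base as ℕ using (ℕ; zero; suc)
  import Data.Nat.Properties as ℕ
  open import Data.Product.Base using (Σ; ∃; _×_; _,_; proj₁; proj₂)
  open import Data.Sum.Base using (_⊎_; inj₁; inj₂)
  open import Data.Unit.Polymorphic.Base using (⊤)
  open import Function.Base using (_∘_)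
  import Relation.Binary.PropositionalEquality as ≡
  open ≡ using (_≡_)
  open import Relation.Nullary.Decidable using (decidable-stable)
  open import Relation.Nullary.Negation using (¬_; contradiction)
  open import Relation.Unary using (Pred)
  import Relation.Binary.Reasoning.Setoid as ≈-Reasoning

  module Linear {c ℓ₁ ℓ₂ a ℓ : Level} (K : HeytingField c ℓ₁ ℓ₂) (A : CommutativeAlgebra K a ℓ) where
    private
      module K where
        open HeytingField K public
        open CommutativeRing (HeytingCommutativeRing.commutativeRing heytingCommutativeRing) public
          using (ring)
      module KP = RingProperties K.ring
    open CommutativeAlgebra A hiding (zero)
    open RingProperties ring using (-‿distribˡ-*)
    open IsRingHomomorphism isRingHomomorphism
      using (⟦⟧-cong; +-homo; *-homo; -‿homo; 0#-homo; 1#-homo)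

    1≉0 : ¬ K.1# K.≈ K.0#
    1≉0 1≈0 = proj₂ (K.tight K.1# K.0#) 1≈0 (K.invertible⇒# (K.1# ,
      K.trans (K.*-identityˡ _) 1-0≈1 , K.trans (K.*-identityʳ _) 1-0≈1))
      where
      1-0≈1 : K.1# K.- K.0# K.≈ K.1#
      1-0≈1 = K.trans (K.+-congˡ KP.-0#≈0#) (K.+-identityʳ K.1#)

    -- An element not apart from 0 equals 0 by tightness, and one apart from 0 is invertible. Under
    -- double negation this dichotomy is available.
    zero⊎invertible : ∀ k → ¬ ¬ (k K.≈ K.0# ⊎ ∃ λ k⁻¹ → k⁻¹ K.* k K.≈ K.1#)
    zero⊎invertible k ¬dec = ¬dec (inj₁ (proj₁ (K.tight k K.0#) λ k#0 →
      let k⁻¹ , inv , _ = K.#⇒invertible k#0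
      in ¬dec (inj₂ (k⁻¹ , K.trans (K.*-congˡ (K.sym k-0≈k)) inv))))
      where
      k-0≈k : k K.- K.0# K.≈ k
      k-0≈k = K.trans (K.+-congˡ KP.-0#≈0#) (K.+-identityʳ k)

    0•≈0 : ∀ x → K.0# • x ≈ 0#
    0•≈0 x = trans (*-congʳ 0#-homo) (zeroˡ x)

    1•≈ : ∀ x → K.1# • x ≈ x
    1•≈ x = trans (*-congʳ 1#-homo) (*-identityˡ x)

    •-assoc : ∀ k l x → k • l • x ≈ (k K.* l) • x
    •-assoc k l x = trans (sym (*-assoc (ι k) (ι l) x)) (*-congʳ (sym (*-homo k l)))

    -•≈ : ∀ k x → (K.- k) • x ≈ -ᴬ (k • x)
    -•≈ k x = trans (*-congʳ (-‿homo k)) (sym (-‿distribˡ-* (ι k) x))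

    +-cancel-neg : ∀ k x → k • x +ᴬ (K.- k) • x ≈ 0#
    +-cancel-neg k x = trans (+-congˡ (-•≈ k x)) (-‿inverseʳ (k • x))

    •-*-comm : ∀ k x y → x *ᴬ (k • y) ≈ k • (x *ᴬ y)
    •-*-comm k x y = trans (sym (*-assoc x (ι k) y)) (trans (*-congʳ (*-comm x (ι k))) (*-assoc (ι k) x y))

    +-interchange : ∀ x y z w → (x +ᴬ y) +ᴬ (z +ᴬ w) ≈ (x +ᴬ z) +ᴬ (y +ᴬ w)
    +-interchange x y z w = begin
      (x +ᴬ y) +ᴬ (z +ᴬ w)   ≈⟨ +-assoc x y _ ⟩
      x +ᴬ (y +ᴬ (z +ᴬ w))   ≈⟨ +-congˡ (+-assoc y z w) ⟨
      x +ᴬ ((y +ᴬ z) +ᴬ w)   ≈⟨ +-congˡ (+-congʳ (+-comm y z)) ⟩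
      x +ᴬ ((z +ᴬ y) +ᴬ w)   ≈⟨ +-congˡ (+-assoc z y w) ⟩
      x +ᴬ (z +ᴬ (y +ᴬ w))   ≈⟨ +-assoc x z _ ⟨
      (x +ᴬ z) +ᴬ (y +ᴬ w)   ∎
      where open ≈-Reasoning setoid

    Span : List Carrier → Pred Carrier (c ⊔ a ⊔ ℓ)
    Span []       x = Σ ⊤ λ (_ : ⊤ {c ⊔ a}) → x ≈ 0#
    Span (v ∷ vs) x = ∃ λ k → ∃ λ w → Span vs w × x ≈ k • v +ᴬ w

    span-resp : ∀ vs {x y} → x ≈ y → Span vs x → Span vs y
    span-resp []       x≈y (_ , x≈0)           = _ , trans (sym x≈y) x≈0
    span-resp (v ∷ vs) x≈y (k , w , w∈ , x≈kv+w) = k , w , w∈ , trans (sym x≈y) x≈kv+w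

    span-0 : ∀ vs → Span vs 0#
    span-0 []       = _ , refl
    span-0 (v ∷ vs) = K.0# , 0# , span-0 vs , sym (trans (+-identityʳ _) (0•≈0 v))

    span-+ : ∀ vs {x y} → Span vs x → Span vs y → Span vs (x +ᴬ y)
    span-+ []       (_ , x≈0) (_ , y≈0) = _ , trans (+-cong x≈0 y≈0) (+-identityʳ 0#)
    span-+ (v ∷ vs) (k , w , w∈ , x≈) (l , z , z∈ , y≈) = k K.+ l , w +ᴬ z , span-+ vs w∈ z∈ ,
      trans (+-cong x≈ y≈) (trans (+-interchange _ _ _ _)
        (+-congʳ (sym (trans (*-congʳ (+-homo k l)) (distribʳ v (ι k) (ι l))))))

    span-• : ∀ vs k {x} → Span vs x → Span vs (k • x)
    span-• []       k (_ , x≈0) = _ , trans (*-congˡ x≈0) (zeroʳ (ι k))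
    span-• (v ∷ vs) k (l , w , w∈ , x≈) = k K.* l , k • w , span-• vs k w∈ ,
      trans (*-congˡ x≈) (trans (distribˡ (ι k) _ _) (+-congʳ (•-assoc k l v)))

    span-isSubspace : ∀ vs → IsSubspace (Span vs)
    span-isSubspace vs = record
      { resp = span-resp vs ; 0-closed = span-0 vs ; +-closed = span-+ vs ; •-closed = span-• vs }

    span-head : ∀ v vs → Span (v ∷ vs) v
    span-head v vs = K.1# , 0# , span-0 vs , sym (trans (+-identityʳ _) (1•≈ v))

    span-tail : ∀ v vs {x} → Span vs x → Span (v ∷ vs) x
    span-tail v vs {x} x∈ = K.0# , x , x∈ , sym (trans (+-congʳ (0•≈0 v)) (+-identityˡ x))

    span-members : ∀ vs → All (Span vs) vs
    span-members []       = []
    span-members (v ∷ vs) = span-head v vs ∷ All.map (span-tail v vs) (span-members vs)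

    span-least : ∀ {p} {W : Pred Carrier p} → IsSubspace W → ∀ {vs} → All W vs → ∀ {x} → Span vs x → W x
    span-least isW []         (_ , x≈0) = IsSubspace.resp isW (sym x≈0) (IsSubspace.0-closed isW)
    span-least isW (v∈ ∷ vs∈) (k , w , w∈ , x≈) = IsSubspace.resp isW (sym x≈)
      (IsSubspace.+-closed isW (IsSubspace.•-closed isW k v∈) (span-least isW vs∈ w∈))

    -- A negative form suited to ordered lists: each vector avoids the span of the later ones, which
    -- for decreasing monomials are the smaller ones.
    Independent : List Carrier → Set (c ⊔ a ⊔ ℓ)
    Independent []       = ⊤
    Independent (u ∷ us) = ¬ Span us u × Independent us

    -- Gaussian elimination of v from us, with pivot p.
    record Pivot (v : Carrier) (vs us : List Carrier) : Set (c ⊔ ℓ₁ ⊔ a ⊔ ℓ) where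
      field
        rest         : List Carrier
        length-rest  : length us ≡ suc (length rest)
        independent  : Independent rest
        rest⊆        : All (Span vs) rest
        pivot        : Carrier
        ⊆us          : ∀ {x} → Span (pivot ∷ rest) x → Span us x
        coefficient  : K.Carrier
        inverse      : K.Carrier
        invertible   : inverse K.* coefficient K.≈ K.1#
        remainder    : Carrier
        remainder∈   : Span vs remainder
        pivot≈       : pivot ≈ coefficient • v +ᴬ remainder

    -- The list is processed from its end. The first invertible v-coefficient met provides the
    -- pivot, and a multiple of it is subtracted from every vector before it.
    eliminate : ∀ v vs us → Independent us → All (Span (v ∷ vs)) us →
      ¬ ¬ (All (Span vs) us ⊎ Pivot v vs us)
    eliminate v vs []       ind        []         ¬goal = ¬goal (inj₁ [])
    eliminate v vs (u ∷ us) (u∉ , ind) ((k , w , w∈ , u≈) ∷ us∈) ¬goal = eliminate v vs us ind us∈ λ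
      { (inj₁ us⊆) → zero⊎invertible k λ
        { (inj₁ k≈0) → ¬goal (inj₁ (span-resp vs (sym (trans u≈ (trans
            (+-congʳ (trans (*-congʳ (⟦⟧-cong k≈0)) (0•≈0 v))) (+-identityˡ w)))) w∈ ∷ us⊆))
        ; (inj₂ (k⁻¹ , k⁻¹k≈1)) → ¬goal (inj₂ record
            { rest = us ; length-rest = ≡.refl ; independent = ind ; rest⊆ = us⊆ ; pivot = u ; ⊆us = λ x∈ → x∈
            ; coefficient = k ; inverse = k⁻¹ ; invertible = k⁻¹k≈1
            ; remainder = w ; remainder∈ = w∈ ; pivot≈ = u≈ }) }
      ; (inj₂ pv) → ¬goal (inj₂ (step pv)) }
      where
      step : Pivot v vs us → Pivot v vs (u ∷ us)
      step pv = record
        { rest = u′ ∷ rest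
        ; length-rest = ≡.cong suc length-rest
        -- If `u′` lay in the span of `rest`, then u, being e • pivot + `u′`, would lie in the span
        -- of `us`.
        ; independent = (λ u′∈ → u∉ (⊆us (span-resp (pivot ∷ rest) (sym u≈ep+u′)
            (e , u′ , u′∈ , refl)))) , independent
        ; rest⊆ = span-+ vs w∈ (span-• vs (K.- e) remainder∈) ∷ rest⊆
        ; pivot = pivot
        ; ⊆us = span-least (span-isSubspace (u ∷ us))
            (span-tail u us pivot∈ ∷
             span-resp (u ∷ us) u-ep≈u′ (span-+ (u ∷ us) (span-head u us)
               (span-• (u ∷ us) (K.- e) (span-tail u us pivot∈))) ∷
             All.map (λ x∈ → span-tail u us (⊆us (span-tail pivot rest x∈))) (span-members rest))
        ; coefficient = coefficient ; inverse = inverse ; invertible = invertible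
        ; remainder = remainder ; remainder∈ = remainder∈ ; pivot≈ = pivot≈ }
        where
        open Pivot pv
        open ≈-Reasoning setoid
        -- The multiple of the pivot whose v-coefficient is k; subtracting it from u removes v and
        -- leaves `u′`.
        e = k K.* inverse
        u′ = w +ᴬ (K.- e) • remainder
        pivot∈ : Span us pivot
        pivot∈ = ⊆us (span-head pivot rest)
        ed≈k : e K.* coefficient K.≈ k
        ed≈k = K.trans (K.*-assoc k inverse coefficient) (K.trans (K.*-congˡ invertible) (K.*-identityʳ k))
        u≈ep+u′ : u ≈ e • pivot +ᴬ u′
        u≈ep+u′ = sym (begin
          e • pivot +ᴬ u′                                        ≈⟨ +-congʳ (*-congˡ pivot≈) ⟩
          e • (coefficient • v +ᴬ remainder) +ᴬ u′               ≈⟨ +-congʳ (distribˡ (ι e) _ _) ⟩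
          (e • coefficient • v +ᴬ e • remainder) +ᴬ u′
            ≈⟨ +-congʳ (+-congʳ (trans (•-assoc e coefficient v) (*-congʳ (⟦⟧-cong ed≈k)))) ⟩
          (k • v +ᴬ e • remainder) +ᴬ (w +ᴬ (K.- e) • remainder) ≈⟨ +-interchange _ _ _ _ ⟩
          (k • v +ᴬ w) +ᴬ (e • remainder +ᴬ (K.- e) • remainder) ≈⟨ +-congˡ (+-cancel-neg e remainder) ⟩
          (k • v +ᴬ w) +ᴬ 0#                                     ≈⟨ +-identityʳ _ ⟩
          k • v +ᴬ w                                             ≈⟨ u≈ ⟨
          u                                                      ∎)
        u-ep≈u′ : u +ᴬ (K.- e) • pivot ≈ u′
        u-ep≈u′ = begin
          u +ᴬ (K.- e) • pivot                       ≈⟨ +-congʳ (trans u≈ep+u′ (+-comm _ _)) ⟩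
          (u′ +ᴬ e • pivot) +ᴬ (K.- e) • pivot       ≈⟨ +-assoc _ _ _ ⟩
          u′ +ᴬ (e • pivot +ᴬ (K.- e) • pivot)       ≈⟨ +-congˡ (+-cancel-neg e pivot) ⟩
          u′ +ᴬ 0#                                   ≈⟨ +-identityʳ u′ ⟩
          u′                                         ∎

    -- Eliminating one spanning vector costs at most one independent vector. The inequality of
    -- lengths is decidable, which discharges the double negation.
    steinitz : ∀ vs us → Independent us → All (Span vs) us → length us ℕ.≤ length vs
    steinitz []       []       ind       us∈               = ℕ.z≤n
    steinitz []       (u ∷ us) (u∉ , _) ((_ , u≈0) ∷ us∈) =
      contradiction (span-resp us (sym u≈0) (span-0 us)) u∉
    steinitz (v ∷ vs) us       ind       us∈ =
      decidable-stable (length us ℕ.≤? suc (length vs)) λ ¬≤ → eliminate v vs us ind us∈ λ where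
        (inj₁ us⊆) → ¬≤ (ℕ.m≤n⇒m≤1+n (steinitz vs us ind us⊆))
        (inj₂ pv)  → let open Pivot pv in
          ¬≤ (≡.subst (ℕ._≤ suc (length vs)) (≡.sym length-rest) (ℕ.s≤s (steinitz vs rest independent rest⊆)))

    linearCombination-span : ∀ {d} k (b : Fin d → Carrier) → Span (List.tabulate b) (linearCombination k b)
    linearCombination-span {zero}  k b = _ , refl
    linearCombination-span {suc d} k b =
      k zero , linearCombination (k ∘ suc) (b ∘ suc) , linearCombination-span (k ∘ suc) (b ∘ suc) , refl

    span-linearCombination : ∀ {d} (b : Fin d → Carrier) {x} → Span (List.tabulate b) x →
      ∃ λ k → x ≈ linearCombination k b
    span-linearCombination {zero}  b (_ , x≈0) = (λ ()) , x≈0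
    span-linearCombination {suc d} b (k₀ , w , w∈ , x≈) with span-linearCombination (b ∘ suc) w∈
    ... | k , w≈ = (λ { zero → k₀ ; (suc i) → k i }) , trans x≈ (+-congˡ w≈)

    -- If the first vector were in the span of the others, there would be a vanishing combination in
    -- which it has coefficient -1, forcing 1 = 0.
    independent-tabulate : ∀ {d} (b : Fin d → Carrier) →
      (∀ k → linearCombination k b ≈ 0# → ∀ i → k i K.≈ K.0#) → Independent (List.tabulate b)
    independent-tabulate {zero}  b ind = _
    independent-tabulate {suc d} b ind = b₀∉ , independent-tabulate (b ∘ suc) λ k kb≈0 i →
      ind (λ { zero → K.0# ; (suc i) → k i }) (trans (+-cong (0•≈0 (b zero)) kb≈0) (+-identityʳ 0#)) (suc i)
      where
      b₀∉ : ¬ Span (List.tabulate (b ∘ suc)) (b zero)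
      b₀∉ b₀∈ with span-linearCombination (b ∘ suc) b₀∈
      ... | k , b₀≈ = 1≉0 (K.trans (K.sym (KP.-‿involutive K.1#)) (K.trans (K.-‿cong -1≈0) KP.-0#≈0#))
        where
        -1≈0 : K.- K.1# K.≈ K.0#
        -1≈0 = ind (λ { zero → K.- K.1# ; (suc i) → k i })
          (trans (+-cong (trans (-•≈ K.1# (b zero)) (-‿cong (1•≈ (b zero)))) (sym b₀≈)) (-‿inverseˡ (b zero)))
          zero

    basis-span : ∀ {p d} {V : Pred Carrier p} {b : Fin d → Carrier} → IsBasis V b →
      ∀ {x} → V x → Span (List.tabulate b) x
    basis-span {b = b} isBasis x∈ with IsBasis.spanning isBasis x∈
    ... | k , x≈ = span-resp (List.tabulate b) (sym x≈) (linearCombination-span k b)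

-- The lexicographic order on monomials

module LexicographicOrder where
  open MonomialSums
  open import Data.Fin.Base using (Fin; zero; suc)
  open import Data.List.Base as List using (List; []; _∷_; _++_)
  open import Data.List.Membership.Propositional using (_∈_)
  open import Data.List.Membership.Propositional.Properties using (∈-map⁺; ∈-++⁺ˡ; ∈-++⁺ʳ)
  open import Data.List.Properties using (map-++; map-∘)
  open import Data.List.Relation.Unary.All as All using (All; []; _∷_)
  import Data.List.Relation.Unary.All.Properties as All
  open import Data.List.Relation.Unary.AllPairs as AllPairs using (AllPairs; []; _∷_)
  import Data.List.Relation.Unary.AllPairs.Properties as AllPairs
  open import Data.List.Relation.Unary.Any using (here)
  open import Data.Nat.Base as ℕ using (ℕ; zero; suc)
  open import Data.Nat.ListAction using (sum)
  open import Data.Nat.ListAction.Properties using (sum-++)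
  import Data.Nat.Properties as ℕ
  open import Data.Vec.Base as Vec using (Vec; []; _∷_)
  open import Function.Base using (_∘_)
  open import Relation.Binary.PropositionalEquality
  open import Relation.Nullary.Negation using (¬_)

  infix 4 _≺_

  data _≺_ : ∀ {n} → Vec ℕ n → Vec ℕ n → Set where
    this : ∀ {n a b} {m m′ : Vec ℕ n} → a ℕ.< b → (a ∷ m) ≺ (b ∷ m′)
    next : ∀ {n a} {m m′ : Vec ℕ n} → m ≺ m′ → (a ∷ m) ≺ (a ∷ m′)

  ≺-asym : ∀ {n} {m m′ : Vec ℕ n} → m ≺ m′ → ¬ m′ ≺ m
  ≺-asym (this a<b) (this b<a) = ℕ.<-asym a<b b<a
  ≺-asym (this a<a) (next _)   = ℕ.<-irrefl refl a<a
  ≺-asym (next _)   (this a<a) = ℕ.<-irrefl refl a<a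
  ≺-asym (next m≺)  (next ≺m)  = ≺-asym m≺ ≺m

  -- Compatibility with multiplication, through which reducibility passes to multiples.
  ≺-bump : ∀ {n} v {m m′ : Vec ℕ n} → m ≺ m′ → bump v m ≺ bump v m′
  ≺-bump zero    (this a<b) = this (ℕ.s≤s a<b)
  ≺-bump zero    (next m≺)  = next m≺
  ≺-bump (suc v) (this a<b) = this a<b
  ≺-bump (suc v) (next m≺)  = next (≺-bump v m≺)

  sum-bump : ∀ {n} v (m : Vec ℕ n) → Vec.sum (bump v m) ≡ suc (Vec.sum m)
  sum-bump zero    (a ∷ m) = refl
  sum-bump (suc v) (a ∷ m) = trans (cong (a ℕ.+_) (sum-bump v m)) (ℕ.+-suc a (Vec.sum m))

  -- Follows the recursion of `∑ᵐ`; placing the multiples of the first variable first makes the list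
  -- decreasing.
  monomials : ∀ n (d : ℕ) → List (Vec ℕ n)
  monomials zero    zero    = [] ∷ []
  monomials zero    (suc d) = []
  monomials (suc n) zero    = List.map (0 ∷_) (monomials n zero)
  monomials (suc n) (suc d) =
    List.map (bump zero) (monomials (suc n) d) ++ List.map (0 ∷_) (monomials n (suc d))

  monomials-degree : ∀ n d → All (λ m → Vec.sum m ≡ d) (monomials n d)
  monomials-degree zero    zero    = refl ∷ []
  monomials-degree zero    (suc d) = []
  monomials-degree (suc n) zero    = All.map⁺ (monomials-degree n zero)
  monomials-degree (suc n) (suc d) = All.++⁺
    (All.map⁺ (All.map (λ {m} eq → trans (sum-bump zero m) (cong suc eq)) (monomials-degree (suc n) d)))
    (All.map⁺ (monomials-degree n (suc d)))

  ∈-monomials : ∀ {n} d (m : Vec ℕ n) → Vec.sum m ≡ d → m ∈ monomials n d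
  ∈-monomials zero    []          eq = here refl
  ∈-monomials zero    (zero ∷ m)  eq = ∈-map⁺ (0 ∷_) (∈-monomials zero m eq)
  ∈-monomials (suc d) (zero ∷ m)  eq =
    ∈-++⁺ʳ (List.map (bump zero) (monomials _ d)) (∈-map⁺ (0 ∷_) (∈-monomials (suc d) m eq))
  ∈-monomials (suc d) (suc a ∷ m) eq =
    ∈-++⁺ˡ (∈-map⁺ (bump zero) (∈-monomials d (a ∷ m) (ℕ.suc-injective eq)))

  monomials-decreasing : ∀ n d → AllPairs (λ m m′ → m′ ≺ m) (monomials n d)
  monomials-decreasing zero    zero    = [] ∷ []
  monomials-decreasing zero    (suc d) = []
  monomials-decreasing (suc n) zero    =
    AllPairs.map⁺ (AllPairs.map next (monomials-decreasing n zero))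
  monomials-decreasing (suc n) (suc d) = AllPairs.++⁺
    (AllPairs.map⁺ (AllPairs.map (≺-bump zero) (monomials-decreasing (suc n) d)))
    (AllPairs.map⁺ (AllPairs.map next (monomials-decreasing n (suc d))))
    -- Across the two blocks, the first exponent is positive on the left and zero on the right.
    (All.map⁺ (All.universal (λ { (a ∷ m) → All.map⁺ (All.universal (λ m′ → this (ℕ.s≤s ℕ.z≤n)) _) }) _))

  ∑ᵐ-monomials : ∀ n d (f : Vec ℕ n → ℕ) → ∑ᵐ n d f ≡ sum (List.map f (monomials n d))
  ∑ᵐ-monomials zero    zero    f = sym (ℕ.+-identityʳ (f []))
  ∑ᵐ-monomials zero    (suc d) f = refl
  ∑ᵐ-monomials (suc n) zero    f = trans (∑ᵐ-monomials n zero (f ∘ (0 ∷_))) (cong sum (map-∘ (monomials n zero)))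
  ∑ᵐ-monomials (suc n) (suc d) f = begin
    ∑ᵐ (suc n) d (f ∘ bump zero) ℕ.+ ∑ᵐ n (suc d) (f ∘ (0 ∷_))
      ≡⟨ cong₂ ℕ._+_ (∑ᵐ-monomials (suc n) d _) (∑ᵐ-monomials n (suc d) _) ⟩
    sum (List.map (f ∘ bump zero) xs) ℕ.+ sum (List.map (f ∘ (0 ∷_)) ys)
      ≡⟨ cong₂ (λ u v → sum u ℕ.+ sum v) (map-∘ xs) (map-∘ ys) ⟩
    sum (List.map f (List.map (bump zero) xs)) ℕ.+ sum (List.map f (List.map (0 ∷_) ys))
      ≡⟨ sum-++ (List.map f (List.map (bump zero) xs)) _ ⟨
    sum (List.map f (List.map (bump zero) xs) ++ List.map f (List.map (0 ∷_) ys))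
      ≡⟨ cong sum (map-++ f (List.map (bump zero) xs) _) ⟨
    sum (List.map f (monomials (suc n) (suc d))) ∎
    where
    open ≡-Reasoning
    xs = monomials (suc n) d
    ys = monomials n (suc d)

-- Hilbert functions and standard monomials

module HilbertFunctions where
  open MonomialSums
  open LexicographicOrder
  open LinearAlgebra
  open RationalBound
  open RealBounds
  open import Level using (Level; _⊔_)
  open import Algebra.Apartness.Bundles using (HeytingField)
  open import Algebra.Morphism.Structures using (IsRingHomomorphism)
  import Algebra.Properties.CommutativeMonoid.Sum as Sum
  import Algebra.Properties.Group as GroupProperties
  open import Data.Fin.Base using (Fin; zero; suc; toℕ; fromℕ<)
  open import Data.Fin.Properties using (toℕ-fromℕ<)
  open import Data.List.Base as List using (List; []; _∷_; length)
  open import Data.List.Membership.Propositional using (_∈_)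
  open import Data.List.Properties using (length-map; length-tabulate)
  open import Data.List.Relation.Unary.All as All using (All; []; _∷_)
  import Data.List.Relation.Unary.All.Properties as All
  open import Data.List.Relation.Unary.AllPairs using (AllPairs; []; _∷_)
  open import Data.List.Relation.Unary.Any using (here; there)
  open import Data.Nat.Base as ℕ using (ℕ; zero; suc; _!)
  import Data.Nat.Properties as ℕ
  open import Data.Nat.ListAction as ℕ using ()
  open import Data.Product.Base using (Σ; ∃; _×_; _,_; proj₁; proj₂)
  open import Data.Rational.Base as ℚ using (1ℚ; _≤_; _+_; _*_)
  import Data.Rational.Properties as ℚ
  open import Data.Sum.Base using (_⊎_; inj₁; inj₂)
  open import Data.Vec.Base as Vec using (Vec; []; _∷_)
  open import Data.Vec.Properties using (≡-dec)
  open import Function.Base using (_∘_)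
  import Relation.Binary.PropositionalEquality as ≡
  open ≡ using (_≡_)
  open import Relation.Binary.Definitions using (DecidableEquality)
  open import Relation.Nullary.Decidable using (Dec; yes; no; decidable-stable; ¬¬-excluded-middle)
  open import Relation.Nullary.Negation using (¬_; contradiction)
  open import Relation.Unary using (Pred; U)

  -- The value 1 marks the failure of P, since P will be reducibility and the irreducible monomials
  -- are to be counted.
  Indicates : ∀ {i p} {I : Set i} → (I → ℕ) → Pred I p → Pred I p
  Indicates f P x = (f x ≡ 0 × P x) ⊎ (f x ≡ 1 × ¬ P x)

  -- Excluded middle is used once for each entry of a finite list, so its double-negated form
  -- suffices.
  indicator : ∀ {i p} {I : Set i} → DecidableEquality I → (P : Pred I p) (xs : List I) →
    ¬ ¬ (Σ (I → ℕ) λ f → All (Indicates f P) xs)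
  indicator _≟_ P []       ¬f = ¬f ((λ _ → 0) , [])
  indicator {I = I} _≟_ P (x ∷ xs) ¬f = indicator _≟_ P xs λ (f , fs) → ¬¬-excluded-middle λ P? →
    ¬f (update f P? , new f P? ∷ All.map (λ {y} → old f P? y) fs)
    where
    value : Dec (P x) → ℕ
    value (yes _) = 0
    value (no  _) = 1
    value-indicates : ∀ P? {n} → n ≡ value P? → (n ≡ 0 × P x) ⊎ (n ≡ 1 × ¬ P x)
    value-indicates (yes p) eq = inj₁ (eq , p)
    value-indicates (no ¬p) eq = inj₂ (eq , ¬p)
    update : (I → ℕ) → Dec (P x) → I → ℕ
    update f P? y with y ≟ x
    ... | yes _ = value P?
    ... | no  _ = f y
    new : ∀ f P? → Indicates (update f P?) P x
    new f P? with x ≟ x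
    ... | yes _  = value-indicates P? ≡.refl
    ... | no x≢x = contradiction ≡.refl x≢x
    old : ∀ f P? y → Indicates f P y → Indicates (update f P?) P y
    old f P? y ind with y ≟ x
    ... | yes ≡.refl = value-indicates P? ≡.refl
    ... | no  _      = ind

  select : ∀ {i} {I : Set i} → (I → ℕ) → List I → List I
  select f []       = []
  select f (x ∷ xs) with f x
  ... | zero  = select f xs
  ... | suc _ = x ∷ select f xs

  All-select : ∀ {i q} {I : Set i} {Q : Pred I q} f {xs} → All Q xs → All Q (select f xs)
  All-select f []                 = []
  All-select f {x ∷ _} (qx ∷ qxs) with f x
  ... | zero  = All-select f qxs
  ... | suc _ = qx ∷ All-select f qxs

  length-select : ∀ {i p} {I : Set i} {P : Pred I p} f {xs} → All (Indicates f P) xs →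
    length (select f xs) ≡ ℕ.sum (List.map f xs)
  length-select f []               = ≡.refl
  length-select f {x ∷ _} (i ∷ is) with f x | i
  ... | zero        | _                 = length-select f is
  ... | suc zero    | _                 = ≡.cong suc (length-select f is)
  ... | suc (suc _) | inj₁ (() , _)
  ... | suc (suc _) | inj₂ (() , _)

  -- Monomials span each graded component

  module Graded {c ℓ₁ ℓ₂ a ℓ p : Level} (K : HeytingField c ℓ₁ ℓ₂) (R : StandardGradedAlgebra K a ℓ p) where
    private
      module K = HeytingField K
    open StandardGradedAlgebra R hiding (zero; independent)
    open StandardGradedAlgebra R using () renaming (independent to components-independent)
    open Linear K algebra
    open GroupProperties +-group using (x∙y⁻¹≈ε⇒x≈y)
    open IsRingHomomorphism isRingHomomorphism using (1#-homo; 0#-homo)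
    open Sum +-commutativeMonoid using (∑-distrib-+; sum-replicate-zero)

    private
      G = proj₁ generated
      g = proj₁ (proj₂ generated)

    -- This is xⁿy; with y built in, raising the first exponent multiplies by x definitionally.
    power : Carrier → ℕ → Carrier → Carrier
    power x zero    y = y
    power x (suc n) y = x *ᴬ power x n y

    eval : ∀ {n} → (Fin n → Carrier) → Vec ℕ n → Carrier
    eval g []      = 1#
    eval g (b ∷ m) = power (g zero) b (eval (g ∘ suc) m)

    *-exchange : ∀ x y z → x *ᴬ (y *ᴬ z) ≈ y *ᴬ (x *ᴬ z)
    *-exchange x y z = trans (sym (*-assoc x y z)) (trans (*-congʳ (*-comm x y)) (*-assoc y x z))

    power-* : ∀ x n {y y′} z → y′ ≈ z *ᴬ y → power x n y′ ≈ z *ᴬ power x n y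
    power-* x zero    z eq = eq
    power-* x (suc n) z eq = trans (*-congˡ (power-* x n z eq)) (*-exchange x z _)

    eval-bump : ∀ {n} (g : Fin n → Carrier) v m → eval g (bump v m) ≈ g v *ᴬ eval g m
    eval-bump g zero    (b ∷ m) = refl
    eval-bump g (suc v) (b ∷ m) = power-* (g zero) b (g (suc v)) (eval-bump (g ∘ suc) v m)

    eval-zeros : ∀ {n} (g : Fin n → Carrier) → eval g (Vec.replicate n 0) ≈ 1#
    eval-zeros {zero}  g = refl
    eval-zeros {suc n} g = eval-zeros (g ∘ suc)

    component-1 : component 0 1#
    component-1 = IsSubspace.resp (component-isSubspace 0) 1#-homo (ι-component₀ K.1#)

    eval-component : ∀ {n} (g : Fin n → Carrier) → (∀ i → component 1 (g i)) →
      ∀ m → component (Vec.sum m) (eval g m)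
    eval-component g g∈ []      = component-1
    eval-component g g∈ (b ∷ m) = power-component b
      where
      power-component : ∀ b → component (b ℕ.+ Vec.sum m) (power (g zero) b (eval (g ∘ suc) m))
      power-component zero    = eval-component (g ∘ suc) (g∈ ∘ suc) m
      power-component (suc b) = *-graded (g∈ zero) (power-component b)

    -- The span of the monomials satisfying Q, of which there may be infinitely many.
    data Generated (Q : Vec ℕ G → Set) : Pred Carrier (c ⊔ a ⊔ ℓ) where
      zero : ∀ {x} → x ≈ 0# → Generated Q x
      term : ∀ {x w} k m → Q m → Generated Q w → x ≈ k • eval g m +ᴬ w → Generated Q x

    module _ {Q : Vec ℕ G → Set} where
      generated-resp : ∀ {x y} → x ≈ y → Generated Q x → Generated Q y
      generated-resp x≈y (zero x≈0)         = zero (trans (sym x≈y) x≈0)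
      generated-resp x≈y (term k m q w∈ x≈) = term k m q w∈ (trans (sym x≈y) x≈)

      generated-+ : ∀ {x y} → Generated Q x → Generated Q y → Generated Q (x +ᴬ y)
      generated-+ (zero x≈0)         y∈ = generated-resp (sym (trans (+-congʳ x≈0) (+-identityˡ _))) y∈
      generated-+ (term k m q w∈ x≈) y∈ =
        term k m q (generated-+ w∈ y∈) (trans (+-congʳ x≈) (+-assoc _ _ _))

      generated-• : ∀ k {x} → Generated Q x → Generated Q (k • x)
      generated-• k (zero x≈0)         = zero (trans (*-congˡ x≈0) (zeroʳ (ι k)))
      generated-• k (term l m q w∈ x≈) = term (k K.* l) m q (generated-• k w∈)
        (trans (*-congˡ x≈) (trans (distribˡ (ι k) _ _) (+-congʳ (•-assoc k l _))))

      generated-isSubspace : IsSubspace (Generated Q)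
      generated-isSubspace = record
        { resp = generated-resp ; 0-closed = zero refl ; +-closed = generated-+ ; •-closed = generated-• }

      generated-eval : ∀ m → Q m → Generated Q (eval g m)
      generated-eval m q = term K.1# m q (zero refl) (sym (trans (+-identityʳ _) (1•≈ _)))

      generated-least : ∀ {p} {W : Pred Carrier p} → IsSubspace W → (∀ m → Q m → W (eval g m)) →
        ∀ {x} → Generated Q x → W x
      generated-least isW W-eval (zero x≈0) = IsSubspace.resp isW (sym x≈0) (IsSubspace.0-closed isW)
      generated-least isW W-eval (term k m q w∈ x≈) = IsSubspace.resp isW (sym x≈)
        (IsSubspace.+-closed isW (IsSubspace.•-closed isW k (W-eval m q)) (generated-least isW W-eval w∈))

      generated-*-generator : ∀ {Q′ : Vec ℕ G → Set} v → (∀ m → Q m → Q′ (bump v m)) →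
        ∀ {x} → Generated Q x → Generated Q′ (g v *ᴬ x)
      generated-*-generator v Q→Q′ (zero x≈0) = zero (trans (*-congˡ x≈0) (zeroʳ (g v)))
      generated-*-generator v Q→Q′ (term k m q w∈ x≈) =
        term k (bump v m) (Q→Q′ m q) (generated-*-generator v Q→Q′ w∈)
          (trans (*-congˡ x≈) (trans (distribˡ (g v) _ _) (+-congʳ
            (trans (•-*-comm k (g v) _) (*-congˡ (sym (eval-bump g v m)))))))

    -- Elements of the subalgebra are treated as multiplication operators on the span, so a product
    -- is a composition and no two sums need be multiplied out.
    adjoin-generated : ∀ {x} → Adjoin g x → ∀ {y} → Generated U y → Generated U (x *ᴬ y)
    adjoin-generated (generator i) y∈ = generated-*-generator i (λ _ _ → _) y∈
    adjoin-generated (scalar k)    y∈ = generated-• k y∈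
    adjoin-generated (plus x∈ z∈)  y∈ = generated-resp (sym (distribʳ _ _ _))
      (generated-+ (adjoin-generated x∈ y∈) (adjoin-generated z∈ y∈))
    adjoin-generated (times x∈ z∈) y∈ = generated-resp (sym (*-assoc _ _ _))
      (adjoin-generated x∈ (adjoin-generated z∈ y∈))
    adjoin-generated (resp x≈ x∈)  y∈ = generated-resp (*-congʳ x≈) (adjoin-generated x∈ y∈)

    all-generated : ∀ x → Generated U x
    all-generated x = generated-resp (trans (*-congˡ (eval-zeros g)) (*-identityʳ x))
      (adjoin-generated (proj₂ (proj₂ (proj₂ generated)) x) (generated-eval (Vec.replicate G 0) _))

    OfDegree : ℕ → Vec ℕ G → Set
    OfDegree d m = Vec.sum m ≡ d

    generated-component : ∀ d {x} → Generated (OfDegree d) x → component d x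
    generated-component d = generated-least (component-isSubspace d)
      λ { m ≡.refl → eval-component g (proj₁ (proj₂ (proj₂ generated))) m }

    single : ℕ → Carrier → ℕ → Carrier
    single zero    y zero    = y
    single zero    y (suc j) = 0#
    single (suc d) y zero    = 0#
    single (suc d) y (suc j) = single d y j

    single-diagonal : ∀ d y → single d y d ≡ y
    single-diagonal zero    y = ≡.refl
    single-diagonal (suc d) y = single-diagonal d y

    single∈ : ∀ {p} (W : ℕ → Pred Carrier p) → (∀ j → IsSubspace (W j)) → ∀ d {y} → W d y →
      ∀ j → W j (single d y j)
    single∈ W isW zero    y∈ zero    = y∈
    single∈ W isW zero    y∈ (suc j) = IsSubspace.0-closed (isW (suc j))
    single∈ W isW (suc d) y∈ zero    = IsSubspace.0-closed (isW zero)
    single∈ W isW (suc d) y∈ (suc j) = single∈ (W ∘ suc) (isW ∘ suc) d y∈ j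

    sum-single : ∀ d y n → d ℕ.< n → sum {n} (single d y ∘ toℕ) ≈ y
    sum-single zero    y (suc n) _           = trans (+-congˡ (sum-replicate-zero n)) (+-identityʳ y)
    sum-single (suc d) y (suc n) (ℕ.s≤s d<n) = trans (+-identityˡ _) (sum-single d y n d<n)

    -- Allowing every length n ≥ N lets the decompositions of two summands be added at a common
    -- length.
    homogeneous-parts : ∀ {x} → Generated U x → ∃ λ N → Σ (ℕ → Carrier) λ u →
      (∀ j → Generated (OfDegree j) (u j)) × (∀ n → N ℕ.≤ n → x ≈ sum {n} (u ∘ toℕ))
    homogeneous-parts (zero x≈0) = 0 , (λ _ → 0#) , (λ _ → zero refl) ,
      λ n _ → trans x≈0 (sym (sum-replicate-zero n))
    homogeneous-parts (term k m _ w∈ x≈) =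
      let N , u , u∈ , w≈ = homogeneous-parts w∈
          d = Vec.sum m
          y = k • eval g m
      in N ℕ.⊔ suc d , (λ j → single d y j +ᴬ u j)
       , (λ j → generated-+ (single∈ (λ j → Generated (OfDegree j)) (λ j → generated-isSubspace) d
            (generated-• k (generated-eval m ≡.refl)) j) (u∈ j))
       , λ n n≥ → trans x≈ (trans
           (+-cong (sym (sum-single d y n (ℕ.m⊔n≤o⇒n≤o N (suc d) n≥))) (w≈ n (ℕ.m⊔n≤o⇒m≤o N (suc d) n≥)))
           (sym (∑-distrib-+ {n} (single d y ∘ toℕ) (u ∘ toℕ))))

    -- Subtracting x in degree d from its homogeneous parts gives a graded sum equal to 0.
    -- Directness makes its degree-d term vanish, so x is its own part of degree d.
    component-generated : ∀ d {x} → component d x → Generated (OfDegree d) x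
    component-generated d {x} x∈ =
      let N , u , u∈ , x≈ = homogeneous-parts (all-generated x)
          n   = N ℕ.⊔ suc d
          v   = λ j → u j +ᴬ single d (-ᴬ x) j
          -x∈ = IsSubspace.resp (component-isSubspace d) (trans (-•≈ K.1# x) (-‿cong (1•≈ x)))
                  (IsSubspace.•-closed (component-isSubspace d) (K.- K.1#) x∈)
          v∈ : ∀ j → component j (v j)
          v∈ j = IsSubspace.+-closed (component-isSubspace j) (generated-component j (u∈ j))
                  (single∈ component component-isSubspace d -x∈ j)
          d<n = ℕ.m≤n⊔m N (suc d)
          v≈0 : sum {n} (v ∘ toℕ) ≈ 0#
          v≈0 = trans (∑-distrib-+ {n} (u ∘ toℕ) (single d (-ᴬ x) ∘ toℕ))
                  (trans (+-cong (sym (x≈ n (ℕ.m≤m⊔n N (suc d)))) (sum-single d (-ᴬ x) n d<n)) (-‿inverseʳ x))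
          vd≈0 : v d ≈ 0#
          vd≈0 = ≡.subst (λ j → v j ≈ 0#) (toℕ-fromℕ< d<n)
                   (components-independent {n} (v ∘ toℕ) (v∈ ∘ toℕ) v≈0 (fromℕ< d<n))
          ud≈x : u d ≈ x
          ud≈x = x∙y⁻¹≈ε⇒x≈y (u d) x (≡.subst (λ z → u d +ᴬ z ≈ 0#) (single-diagonal d (-ᴬ x)) vd≈0)
      in generated-resp ud≈x (u∈ d)

    -- Reducible and standard monomials

    Smaller : Vec ℕ G → Vec ℕ G → Set
    Smaller m m′ = Vec.sum m′ ≡ Vec.sum m × m′ ≺ m

    Reducible : Pred (Vec ℕ G) (c ⊔ a ⊔ ℓ)
    Reducible m = Generated (Smaller m) (eval g m)

    -- A relation expressing m by smaller monomials can be multiplied by the generator v. Hence the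
    -- irreducible monomials are closed under division by a variable.
    reducible-bump : ∀ v m → Reducible m → Reducible (bump v m)
    reducible-bump v m red = generated-resp (sym (eval-bump g v m))
      (generated-*-generator v (λ m′ (eq , m′≺) →
        ≡.trans (sum-bump v m′) (≡.trans (≡.cong suc eq) (≡.sym (sum-bump v m))) , ≺-bump v m′≺) red)

    -- The invariant for induction along a decreasing list: every smaller monomial of degree d is
    -- still present in the tail.
    DownClosed : ℕ → List (Vec ℕ G) → Set
    DownClosed d ms = ∀ {m} → m ∈ ms → ∀ {m′} → Vec.sum m′ ≡ d → m′ ≺ m → m′ ∈ ms

    Decreasing : List (Vec ℕ G) → Set
    Decreasing = AllPairs (λ m m′ → m′ ≺ m)

    downClosed-tail : ∀ {d m ms} → Decreasing (m ∷ ms) → DownClosed d (m ∷ ms) → DownClosed d ms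
    downClosed-tail (m> ∷ _) closed n∈ eq n′≺n with closed (there n∈) eq n′≺n
    ... | there n′∈    = n′∈
    ... | here ≡.refl = contradiction n′≺n (≺-asym (All.lookup m> n∈))

    standard : (Vec ℕ G → ℕ) → List (Vec ℕ G) → List Carrier
    standard f ms = List.map (eval g) (select f ms)

    -- Later entries are smaller monomials of the same degree, so lying in their span would make an
    -- entry reducible.
    standard-independent : ∀ {d} f ms → Decreasing ms → All (OfDegree d) ms → All (Indicates f Reducible) ms →
      Independent (standard f ms)
    standard-independent f []       dec        deg          ind        = _
    standard-independent f (m ∷ ms) (m> ∷ dec) (eq ∷ deg)   (i ∷ is) with f m | i
    ... | zero  | _             = standard-independent f ms dec deg is
    ... | suc _ | inj₁ (() , _)
    ... | suc _ | inj₂ (_ , ¬r) = (λ m∈ → ¬r (span-least generated-isSubspace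
        (All.map⁺ (All-select f (All.zipWith (λ { (m′≺ , eq′) →
          generated-eval _ (≡.trans eq′ (≡.sym eq) , m′≺) }) (m> , deg)))) m∈))
      , standard-independent f ms dec deg is

    -- Induction from the smallest monomial upwards: a reducible one is a combination of smaller
    -- ones, all in the tail and already in the span.
    standard-spans : ∀ {d} f ms → Decreasing ms → DownClosed d ms → All (OfDegree d) ms →
      All (Indicates f Reducible) ms → All (Span (standard f ms) ∘ eval g) ms
    standard-spans f [] dec closed deg ind = []
    standard-spans f (m ∷ ms) dec@(_ ∷ dec′) closed (eq ∷ deg) (i ∷ is)
      with f m | i | standard-spans f ms dec′ (downClosed-tail dec closed) deg is
    ... | suc _ | _             | spans = span-head _ _ ∷ All.map (span-tail _ _) spans
    ... | zero  | inj₂ (() , _) | _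
    ... | zero  | inj₁ (_ , r)  | spans = generated-least (span-isSubspace _) smaller r ∷ spans
      where
      smaller : ∀ m′ → Smaller m m′ → Span (standard f ms) (eval g m′)
      smaller m′ (eq′ , m′≺) with closed (here ≡.refl) (≡.trans eq′ eq) m′≺
      ... | there m′∈   = All.lookup spans m′∈
      ... | here ≡.refl = contradiction m′≺ (≺-asym m′≺)

    -- The Hilbert function as a count of standard monomials

    module _ (h : ℕ → ℕ) (isHilbert : IsHilbertFunction h) where

      -- An empty basis of the degree-0 component would force 1 = 0 in the field.
      1≤h₀ : 1 ℕ.≤ h 0
      1≤h₀ with h 0 | isHilbert 0
      ... | suc _ | _ = ℕ.s≤s ℕ.z≤n
      ... | zero  | b , isBasis = contradiction
        (ι-injective (trans 1#-homo (trans (proj₂ (IsBasis.spanning isBasis component-1)) (sym 0#-homo)))) 1≉0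

      module _ {d} {f : Vec ℕ G → ℕ} (ind : All (Indicates f Reducible) (monomials G d)) where

        private
          b       = proj₁ (isHilbert d)
          isBasis = proj₂ (isHilbert d)
          length-standard : length (standard f (monomials G d)) ≡ ∑ᵐ G d f
          length-standard = ≡.trans (length-map (eval g) (select f (monomials G d)))
            (≡.trans (length-select f ind) (≡.sym (∑ᵐ-monomials G d f)))

        ∑ᵐ≤h : ∑ᵐ G d f ℕ.≤ h d
        ∑ᵐ≤h = ≡.subst₂ ℕ._≤_ length-standard (length-tabulate b) (steinitz (List.tabulate b) _
          (standard-independent f _ (monomials-decreasing G d) (monomials-degree G d) ind)
          (All.map⁺ (All-select f (All.map (λ {m} eq → basis-span isBasis
            (generated-component d (generated-eval m eq))) (monomials-degree G d)))))

        h≤∑ᵐ : h d ℕ.≤ ∑ᵐ G d f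
        h≤∑ᵐ = ≡.subst₂ ℕ._≤_ (length-tabulate b) length-standard (steinitz _ (List.tabulate b)
          (independent-tabulate b (IsBasis.independent isBasis))
          (All.tabulate⁺ λ i → generated-least (span-isSubspace _)
            (λ m eq → All.lookup (standard-spans f _ (monomials-decreasing G d)
              (λ _ eq′ _ → ∈-monomials d _ eq′) (monomials-degree G d) ind) (∈-monomials d m eq))
            (component-generated d (IsBasis.member isBasis i))))

      -- The only case to exclude is m reducible with its multiple v·m irreducible, which
      -- `reducible-bump` rules out.
      standard-shadow : ∀ {d f f′} → All (Indicates f′ Reducible) (monomials G (suc d)) →
        All (Indicates f Reducible) (monomials G d) → ShadowIn G d f′ f
      standard-shadow {d} {f} {f′} ind′ ind v m eq
        with All.lookup ind (∈-monomials d m eq)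
           | All.lookup ind′ (∈-monomials (suc d) (bump v m) (≡.trans (sum-bump v m) (≡.cong suc eq)))
      ... | _             | inj₁ (f′≡0 , _)  rewrite f′≡0 = ℕ.z≤n
      ... | inj₂ (f≡1 , _) | inj₂ (f′≡1 , _) rewrite f≡1 | f′≡1 = ℕ.≤-refl
      ... | inj₁ (_ , r)  | inj₂ (_ , ¬r)    = contradiction (reducible-bump v m r) ¬r

      macaulayBound : MacaulayBound h
      -- The goal is a decidable inequality of rationals, so the standard monomials of the two
      -- degrees may be singled out under double negation.
      macaulayBound k q k≤q h≤ = decidable-stable (_ ℚ.≤? _) λ ¬goal →
        indicator (≡-dec ℕ._≟_) Reducible (monomials G (suc k)) λ (f , ind) →
        indicator (≡-dec ℕ._≟_) Reducible (monomials G (suc (suc k))) λ (f′ , ind′) →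
        ¬goal (begin
          toℚ (suc (suc k) ℕ.* h (suc (suc k)))
            ≤⟨ toℚ-mono (ℕ.*-monoʳ-≤ (suc (suc k)) (h≤∑ᵐ ind′)) ⟩
          toℚ (suc (suc k) ℕ.* ∑ᵐ G (suc (suc k)) f′)
            ≤⟨ shadow-bound G k f′ f q k≤q (standard-shadow ind′ ind) (ℚ.≤-trans
                 (ℚ.*-monoˡ-≤-nonNeg (toℚ (suc k !)) {{ℚ.nonNegative (0≤toℚ (suc k !))}} (toℚ-mono (∑ᵐ≤h ind))) h≤) ⟩
          (q + 1ℚ) * toℚ (∑ᵐ G (suc k) f)
            ≤⟨ ℚ.*-monoˡ-≤-nonNeg (q + 1ℚ) {{ℚ.nonNegative (ℚ.≤-trans (0≤toℚ k) (≤⇒≤+1 k≤q))}} (toℚ-mono (∑ᵐ≤h ind)) ⟩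
          (q + 1ℚ) * toℚ (h (suc k)) ∎)
        where open ℚ.≤-Reasoning

-- The bounds in the neighbouring degrees

open import Algebra.Apartness.Bundles using (HeytingField)
open import Data.Nat.Base using (ℕ; zero; suc; _≤_; _∸_)
open import Data.Product.Base using (_×_; _,_)
open RealBounds
open HilbertFunctions

theorem5p10 : ∀ {c ℓ₁ ℓ₂ a ℓ p} (K : HeytingField c ℓ₁ ℓ₂)
    (R : StandardGradedAlgebra K a ℓ p) (h : ℕ → ℕ) →
    StandardGradedAlgebra.IsHilbertFunction R h →
    (r : ℕ) → 1 ≤ r →
    (x : ℝ) → fromℕ (r ∸ 1) ≤ℝ x → fromℕ (h r) ≈ℝ binomial x r →
    (binomial (x -ℝ fromℕ 1) (r ∸ 1) ≤ℝ fromℕ (h (r ∸ 1)))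
    × (fromℕ (h (suc r)) ≤ℝ binomial (x +ℝ fromℕ 1) (suc r))
theorem5p10 K R h isHilbert (suc zero) _ x 0≤x h≈ =
  previous-≥-zero h bound x (Graded.1≤h₀ K R h isHilbert) , next-≤ h bound x zero 0≤x h≈
  where bound = Graded.macaulayBound K R h isHilbert
-- The growth bound is used from degree r-1 to r for the first inequality and from r to r+1 for the
-- second.
theorem5p10 K R h isHilbert (suc (suc k)) _ x k+1≤x h≈ =
  previous-≥ h bound x k k+1≤x h≈ , next-≤ h bound x (suc k) k+1≤x h≈
  where bound = Graded.macaulayBound K R h isHilbert
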